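{- For every integer $n\ge 1$, the reliability polynomial of the Farey graph $G_n$ is $$R(G_n;p)=q^{2^n-1}p^{2^n}\,\frac{2^{n+1}-q^{ -n-1}}{(2-q^{ -1})^{2^{n-1}}}\prod_{i=2}^{n}\left(2^i-q^{ -i}\right)^{2^{n-i}},\qquad q=1-p,$$ as an identity of rational functions in $p$ (an empty product equals $1$; at $q=0$ and $q=1/2$ the right-hand side is understood after cancellation).
   Context: The Farey graphs $G_n$ ($n\ge 0$), each with two distinguished ("special") vertices $X_n,Y_n$, are defined recursively. $G_0$ is a single edge joining its two special vertices $X_0$ and $Y_0$. For $n\ge 1$, take two disjoint copies $G_{n-1}^1,G_{n-1}^2$ of $G_{n-1}$, with special vertices $X_{n-1}^i,Y_{n-1}^i$ ($i=1,2$); identify $Y_{n-1}^1$ with $X_{n-1}^2$ into one vertex, and add a new edge $e_n$ joining $X_{n-1}^1$ and $Y_{n-1}^2$. The result is $G_n$, with special vertices $X_n=X_{n-1}^1$ and $Y_n=Y_{n-1}^2$. It has $2^n+1$ vertices and $2^{n+1}-1$ edges. For a connected graph $G$, the reliability polynomial $R(G;p)$ is the polynomial in $p$ which, for $0\le p\le 1$, equals the probability that the random spanning subgraph $H$ of $G$, obtained by keeping all vertices and independently retaining each edge of $G$ with probability $p$ (deleting it with probability $1-p$), is connected, i.e. that any two vertices are joined by a path in $H$. -}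

module Defs where

open import Algebra.Bundles.Raw using (RawRing)
import Algebra.Definitions.RawSemiring as RawSemiringDefs
open import Data.Bool.Base using (if_then_else_)
open import Data.Fin.Base using (Fin; zero; suc)
open import Data.Fin.Subset using (Subset; inside; outside; _∈_; ∣_∣; ∁)
open import Data.Integer.Base using (+_)
open import Data.List.Base as List using (List; []; _∷_; foldr; applyUpTo)
open import Data.List.Membership.Propositional using () renaming (_∈_ to _∈ᴸ_)
open import Data.List.Membership.Propositional.Properties using (∈-map⁺; ∈-++⁺ˡ; ∈-++⁺ʳ)
open import Data.List.Relation.Unary.All as All using (all?)
open import Data.List.Relation.Unary.Any using (Any; here; there)
open import Data.Nat.Base as ℕ using (ℕ; zero; suc)
open import Data.Product.Base as Product using (_×_; _,_; ∃-syntax)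
open import Data.Rational.Base as ℚ using (ℚ; 0ℚ; 1ℚ)
import Data.Rational.Properties as ℚₚ
open import Data.Sum.Base using (_⊎_; inj₁; inj₂)
open import Data.Vec.Base as Vec using (Vec; []; _∷_; lookup)
open import Data.Vec.Base using (here; there)
open import Function.Base using (_∘_)
open import Level using (0ℓ)
open import Relation.Binary.Construct.Closure.ReflexiveTransitive as Star using (Star; ε; _◅_)
open import Relation.Binary.Definitions using (DecidableEquality)
open import Relation.Binary.PropositionalEquality
open import Relation.Nullary using (Dec; yes; no; does; contradiction)
open import Relation.Nullary.Decidable using (map′; _×-dec_; _⊎-dec_)

infixl 6 _+ᴾ_
infixl 7 _*ᴾ_ _·ᴾ_
infix  8 -ᴾ_
infix  4 _≈ᴾ_

-- Coefficients in ascending order; trailing zeros are allowed, so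
-- polynomials are compared by _≈ᴾ_ rather than by _≡_.
Poly : Set
Poly = List ℚ

coeff : Poly → ℕ → ℚ
coeff []      _       = 0ℚ
coeff (a ∷ _) zero    = a
coeff (_ ∷ f) (suc k) = coeff f k

_≈ᴾ_ : Poly → Poly → Set
f ≈ᴾ g = ∀ k → coeff f k ≡ coeff g k

_+ᴾ_ : Poly → Poly → Poly
[]      +ᴾ g       = g
(a ∷ f) +ᴾ []      = a ∷ f
(a ∷ f) +ᴾ (b ∷ g) = (a ℚ.+ b) ∷ (f +ᴾ g)

_·ᴾ_ : ℚ → Poly → Poly
a ·ᴾ f = List.map (a ℚ.*_) f

_*ᴾ_ : Poly → Poly → Poly
[]      *ᴾ g = []
(a ∷ f) *ᴾ g = (a ·ᴾ g) +ᴾ (0ℚ ∷ (f *ᴾ g))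

-ᴾ_ : Poly → Poly
-ᴾ f = List.map (ℚ.-_) f

ℚ[p] : RawRing 0ℓ 0ℓ
ℚ[p] = record
  { Carrier = Poly
  ; _≈_     = _≈ᴾ_
  ; _+_     = _+ᴾ_
  ; _*_     = _*ᴾ_
  ; -_      = -ᴾ_
  ; 0#      = []
  ; 1#      = 1ℚ ∷ []
  }

open RawSemiringDefs (RawRing.rawSemiring ℚ[p]) public
  using () renaming (_^_ to _^ᴾ_)

pᴾ qᴾ : Poly
pᴾ = 0ℚ ∷ 1ℚ ∷ []
qᴾ = (1ℚ ∷ []) +ᴾ (-ᴾ pᴾ)

NonZeroᴾ : Poly → Set
NonZeroᴾ = Any (_≢ 0ℚ)

ℚ-domain : ∀ {a b} → a ≢ 0ℚ → b ≢ 0ℚ → a ℚ.* b ≢ 0ℚ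
ℚ-domain {a} {b} a≢0 b≢0 ab≡0 = b≢0 (begin
  b                        ≡⟨ ℚₚ.*-identityˡ b ⟨
  1ℚ ℚ.* b                 ≡⟨ cong (ℚ._* b) (ℚₚ.*-inverseˡ a) ⟨
  (ℚ.1/ a) ℚ.* a ℚ.* b     ≡⟨ ℚₚ.*-assoc (ℚ.1/ a) a b ⟩
  (ℚ.1/ a) ℚ.* (a ℚ.* b)   ≡⟨ cong ((ℚ.1/ a) ℚ.*_) ab≡0 ⟩
  (ℚ.1/ a) ℚ.* 0ℚ          ≡⟨ ℚₚ.*-zeroʳ (ℚ.1/ a) ⟩
  0ℚ                       ∎)
  where
  open ≡-Reasoning
  instance a-nonZero = ℚ.≢-nonZero a≢0

fromCoeff : ∀ f k → coeff f k ≢ 0ℚ → NonZeroᴾ f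
fromCoeff []      k       ≢0 = contradiction refl ≢0
fromCoeff (a ∷ f) zero    ≢0 = here ≢0
fromCoeff (a ∷ f) (suc k) ≢0 = there (fromCoeff f k ≢0)

toCoeff : ∀ {f} → NonZeroᴾ f → ∃[ k ] coeff f k ≢ 0ℚ
toCoeff (here ≢0) = 0 , ≢0
toCoeff (there f≢0) with toCoeff f≢0
... | k , ≢0 = suc k , ≢0

NonZero-resp : ∀ {f g} → f ≈ᴾ g → NonZeroᴾ g → NonZeroᴾ f
NonZero-resp {f} f≈g g≢0 with toCoeff g≢0
... | k , ≢0 = fromCoeff f k (subst (_≢ 0ℚ) (sym (f≈g k)) ≢0)

coeff-+ : ∀ f g k → coeff (f +ᴾ g) k ≡ coeff f k ℚ.+ coeff g k
coeff-+ []      g       k       = sym (ℚₚ.+-identityˡ (coeff g k))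
coeff-+ (a ∷ f) []      k       = sym (ℚₚ.+-identityʳ (coeff (a ∷ f) k))
coeff-+ (a ∷ f) (b ∷ g) zero    = refl
coeff-+ (a ∷ f) (b ∷ g) (suc k) = coeff-+ f g k

coeff-· : ∀ a f k → coeff (a ·ᴾ f) k ≡ a ℚ.* coeff f k
coeff-· a []      k       = sym (ℚₚ.*-zeroʳ a)
coeff-· a (b ∷ f) zero    = refl
coeff-· a (b ∷ f) (suc k) = coeff-· a f k

-- (0 ∷ f) is p f.
shiftˡ : ∀ f g → ((0ℚ ∷ f) *ᴾ g) ≈ᴾ (0ℚ ∷ (f *ᴾ g))
shiftˡ f g k = begin
  coeff ((0ℚ ·ᴾ g) +ᴾ (0ℚ ∷ (f *ᴾ g))) k
    ≡⟨ coeff-+ (0ℚ ·ᴾ g) _ k ⟩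
  coeff (0ℚ ·ᴾ g) k ℚ.+ coeff (0ℚ ∷ (f *ᴾ g)) k
    ≡⟨ cong (ℚ._+ coeff (0ℚ ∷ (f *ᴾ g)) k) (trans (coeff-· 0ℚ g k) (ℚₚ.*-zeroˡ (coeff g k))) ⟩
  0ℚ ℚ.+ coeff (0ℚ ∷ (f *ᴾ g)) k
    ≡⟨ ℚₚ.+-identityˡ _ ⟩
  coeff (0ℚ ∷ (f *ᴾ g)) k ∎
  where open ≡-Reasoning

shiftʳ : ∀ f g → (f *ᴾ (0ℚ ∷ g)) ≈ᴾ (0ℚ ∷ (f *ᴾ g))
shiftʳ []      g zero    = refl
shiftʳ []      g (suc k) = refl
shiftʳ (a ∷ f) g zero    = cong (ℚ._+ 0ℚ) (ℚₚ.*-zeroʳ a)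
shiftʳ (a ∷ f) g (suc k) = begin
  coeff ((a ·ᴾ g) +ᴾ (f *ᴾ (0ℚ ∷ g))) k
    ≡⟨ coeff-+ (a ·ᴾ g) _ k ⟩
  coeff (a ·ᴾ g) k ℚ.+ coeff (f *ᴾ (0ℚ ∷ g)) k
    ≡⟨ cong (coeff (a ·ᴾ g) k ℚ.+_) (shiftʳ f g k) ⟩
  coeff (a ·ᴾ g) k ℚ.+ coeff (0ℚ ∷ (f *ᴾ g)) k
    ≡⟨ coeff-+ (a ·ᴾ g) _ k ⟨
  coeff ((a ∷ f) *ᴾ g) k ∎
  where open ≡-Reasoning

head-≢0 : ∀ {a b} f g → a ≢ 0ℚ → b ≢ 0ℚ → NonZeroᴾ ((a ∷ f) *ᴾ (b ∷ g))
head-≢0 {a} {b} f g a≢0 b≢0 =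
  here (ℚ-domain a≢0 b≢0 ∘ trans (sym (ℚₚ.+-identityʳ (a ℚ.* b))))

*ᴾ-nonZero : ∀ {f g} → NonZeroᴾ f → NonZeroᴾ g → NonZeroᴾ (f *ᴾ g)
*ᴾ-nonZero {a ∷ f} {b ∷ g} f≢0 g≢0 with a ℚₚ.≟ 0ℚ | b ℚₚ.≟ 0ℚ
*ᴾ-nonZero {a ∷ f} {b ∷ g} f≢0 g≢0 | no a≢0 | no b≢0 = head-≢0 f g a≢0 b≢0
*ᴾ-nonZero (here a≢0)  g≢0         | yes a≡0 | _ = contradiction a≡0 a≢0
*ᴾ-nonZero {a ∷ f} {g} (there f≢0) g≢0 | yes refl | _ =
  NonZero-resp (shiftˡ f g) (there (*ᴾ-nonZero f≢0 g≢0))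
*ᴾ-nonZero f≢0 (here b≢0)          | no _ | yes b≡0 = contradiction b≡0 b≢0
*ᴾ-nonZero {f} {b ∷ g} f≢0 (there g≢0) | no _ | yes refl =
  NonZero-resp (shiftʳ f g) (there (*ᴾ-nonZero f≢0 g≢0))

infixl 6 _+_ _-_
infixl 7 _*_ _/_⟨_⟩
infix  8 -_
infix  4 _≈_

record RatFun : Set where
  constructor mkRatFun
  field
    num   : Poly
    den   : Poly
    den≢0 : NonZeroᴾ den

open RatFun public

_≈_ : RatFun → RatFun → Set
x ≈ y = (num x *ᴾ den y) ≈ᴾ (num y *ᴾ den x)

fromPoly : Poly → RatFun
fromPoly f = mkRatFun f (1ℚ ∷ []) (here λ ())

_+_ : RatFun → RatFun → RatFun
x + y = mkRatFun (num x *ᴾ den y +ᴾ num y *ᴾ den x) (den x *ᴾ den y)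
                 (*ᴾ-nonZero (den≢0 x) (den≢0 y))

_*_ : RatFun → RatFun → RatFun
x * y = mkRatFun (num x *ᴾ num y) (den x *ᴾ den y)
                 (*ᴾ-nonZero (den≢0 x) (den≢0 y))

-_ : RatFun → RatFun
- x = mkRatFun (-ᴾ num x) (den x) (den≢0 x)

_-_ : RatFun → RatFun → RatFun
x - y = x + (- y)

NonZero : RatFun → Set
NonZero x = NonZeroᴾ (num x)

_/_⟨_⟩ : (x y : RatFun) → NonZero y → RatFun
x / y ⟨ y≢0 ⟩ = mkRatFun (num x *ᴾ den y) (den x *ᴾ num y)
                         (*ᴾ-nonZero (den≢0 x) y≢0)

ℚ⟨p⟩ : RawRing 0ℓ 0ℓ
ℚ⟨p⟩ = record
  { Carrier = RatFun
  ; _≈_     = _≈_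
  ; _+_     = _+_
  ; _*_     = _*_
  ; -_      = -_
  ; 0#      = fromPoly []
  ; 1#      = fromPoly (1ℚ ∷ [])
  }

open RawSemiringDefs (RawRing.rawSemiring ℚ⟨p⟩) public using (_^_)

1# 2# p q : RatFun
1# = fromPoly (1ℚ ∷ [])
2# = fromPoly ((+ 2 ℚ./ 1) ∷ [])
p  = fromPoly pᴾ
q  = 1# - p

q≢0 : NonZero q
q≢0 = here λ ()

q⁻¹ : RatFun
q⁻¹ = 1# / q ⟨ q≢0 ⟩

2-q⁻¹≢0 : NonZero (2# - q⁻¹)
2-q⁻¹≢0 = here λ ()

^-nonZero : ∀ {x} → NonZero x → ∀ m → NonZero (x ^ m)
^-nonZero x≢0 zero    = here λ ()
^-nonZero x≢0 (suc m) = *ᴾ-nonZero x≢0 (^-nonZero x≢0 m)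

∏ : ℕ → ℕ → (ℕ → RatFun) → RatFun
∏ a b f = foldr _*_ 1# (applyUpTo (λ k → f (a ℕ.+ k)) (suc b ℕ.∸ a))

infixr 8 ∏
syntax ∏ a b (λ i → x) = ∏[ a ≤ i ≤ b ] x

module _ {V : Set} where

  Adj : ∀ {m} → Vec (V × V) m → Subset m → V → V → Set
  Adj es H u v = ∃[ e ] (e ∈ H × (lookup es e ≡ (u , v) ⊎ lookup es e ≡ (v , u)))

  Joined : ∀ {m} → Vec (V × V) m → Subset m → V → V → Set
  Joined es H = Star (Adj es H)

  weaken : ∀ {m} {es : Vec (V × V) m} {H e s u v} →
           Adj es H u v → Adj (e ∷ es) (s ∷ H) u v
  weaken (i , i∈H , eq) = suc i , there i∈H , eq

  strengthen : ∀ {m} {es : Vec (V × V) m} {H e u v} →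
               Adj (e ∷ es) (outside ∷ H) u v → Adj es H u v
  strengthen (suc i , there i∈H , eq) = i , i∈H , eq

  -- Joined after adding the edge ab.
  Via : ∀ {m} → Vec (V × V) m → Subset m → V × V → V → V → Set
  Via es H (a , b) u v =
    Joined es H u v ⊎
    (Joined es H u a × Joined es H b v) ⊎
    (Joined es H u b × Joined es H a v)

  fromVia : ∀ {m} {es : Vec (V × V) m} {H ab u v} →
            Via es H ab u v → Joined (ab ∷ es) (inside ∷ H) u v
  fromVia (inj₁ r) = Star.map weaken r
  fromVia (inj₂ (inj₁ (r , s))) =
    Star.map weaken r Star.◅◅ (zero , here , inj₁ refl) ◅ Star.map weaken s
  fromVia (inj₂ (inj₂ (r , s))) =
    Star.map weaken r Star.◅◅ (zero , here , inj₂ refl) ◅ Star.map weaken s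

  toVia : ∀ {m} {es : Vec (V × V) m} {H ab u v} →
          Joined (ab ∷ es) (inside ∷ H) u v → Via es H ab u v
  toVia ε = inj₁ ε
  toVia ((suc i , there i∈H , eq) ◅ rs) with toVia rs
  ... | inj₁ r              = inj₁ ((i , i∈H , eq) ◅ r)
  ... | inj₂ (inj₁ (r , s)) = inj₂ (inj₁ ((i , i∈H , eq) ◅ r , s))
  ... | inj₂ (inj₂ (r , s)) = inj₂ (inj₂ ((i , i∈H , eq) ◅ r , s))
  toVia ((zero , here , inj₁ refl) ◅ rs) with toVia rs
  ... | inj₁ r              = inj₂ (inj₁ (ε , r))
  ... | inj₂ (inj₁ (_ , s)) = inj₂ (inj₁ (ε , s))
  ... | inj₂ (inj₂ (_ , s)) = inj₁ s
  toVia ((zero , here , inj₂ refl) ◅ rs) with toVia rs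
  ... | inj₁ r              = inj₂ (inj₂ (ε , r))
  ... | inj₂ (inj₁ (_ , s)) = inj₁ s
  ... | inj₂ (inj₂ (_ , s)) = inj₂ (inj₂ (ε , s))

  module _ (_≟_ : DecidableEquality V) where

    joined? : ∀ {m} (es : Vec (V × V) m) (H : Subset m) u v → Dec (Joined es H u v)
    joined? [] [] u v = map′ (λ { refl → ε }) (λ { ε → refl }) (u ≟ v)
    joined? (e ∷ es) (outside ∷ H) u v =
      map′ (Star.map weaken) (Star.map strengthen) (joined? es H u v)
    joined? ((a , b) ∷ es) (inside ∷ H) u v = map′ fromVia toVia
      (joined? es H u v ⊎-dec
       ((joined? es H u a ×-dec joined? es H b v) ⊎-dec
        (joined? es H u b ×-dec joined? es H a v)))

-- The order of the two endpoints of an edge is immaterial (see Adj).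
record Graph : Set₁ where
  field
    Vertex   : Set
    _≟_      : DecidableEquality Vertex
    vertices : List Vertex
    complete : ∀ v → v ∈ᴸ vertices
    size     : ℕ
    ends     : Vec (Vertex × Vertex) size

module _ (G : Graph) where
  open Graph G

  Connected : Subset size → Set
  Connected H = ∀ u v → Joined ends H u v

  connected? : ∀ H → Dec (Connected H)
  connected? H =
    map′ (λ all u v → All.lookup (All.lookup all (complete u)) (complete v))
         (λ conn → All.tabulate λ {u} _ → All.tabulate λ {v} _ → conn u v)
         (all? (λ u → all? (joined? _≟_ ends H u) vertices) vertices)

∑Subsets : ∀ m → (Subset m → Poly) → Poly
∑Subsets zero    f = f []
∑Subsets (suc m) f = ∑Subsets m (f ∘ (inside ∷_)) +ᴾ ∑Subsets m (f ∘ (outside ∷_))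

-- A given set H of edges is the set of retained edges with probability
-- p^|H| (1-p)^|E∖H|.
reliability : Graph → Poly
reliability G = ∑Subsets (Graph.size G) λ H →
  if does (connected? G H) then (pᴾ ^ᴾ ∣ H ∣) *ᴾ (qᴾ ^ᴾ ∣ ∁ H ∣) else []

-- The non-special vertices of Gₙ: mid is the identified vertex Y¹ = X².
data Inner : ℕ → Set where
  mid       : ∀ {n} → Inner (suc n)
  inˡ inʳ   : ∀ {n} → Inner n → Inner (suc n)

data FareyVertex (n : ℕ) : Set where
  X Y   : FareyVertex n
  inner : Inner n → FareyVertex n

copy¹ copy² : ∀ {n} → FareyVertex n → FareyVertex (suc n)
copy¹ X         = X
copy¹ Y         = inner mid
copy¹ (inner i) = inner (inˡ i)
copy² X         = inner mid
copy² Y         = Y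
copy² (inner i) = inner (inʳ i)

fareySize : ℕ → ℕ
fareySize zero    = 1
fareySize (suc n) = suc (fareySize n ℕ.+ fareySize n)

fareyEnds : ∀ n → Vec (FareyVertex n × FareyVertex n) (fareySize n)
fareyEnds zero    = (X , Y) ∷ []
fareyEnds (suc n) = (X , Y) ∷
  (Vec.map (Product.map copy¹ copy¹) (fareyEnds n) Vec.++
   Vec.map (Product.map copy² copy²) (fareyEnds n))

_≟ᴵ_ : ∀ {n} → DecidableEquality (Inner n)
mid   ≟ᴵ mid   = yes refl
mid   ≟ᴵ inˡ _ = no λ ()
mid   ≟ᴵ inʳ _ = no λ ()
inˡ _ ≟ᴵ mid   = no λ ()
inˡ i ≟ᴵ inˡ j = map′ (cong inˡ) (λ { refl → refl }) (i ≟ᴵ j)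
inˡ _ ≟ᴵ inʳ _ = no λ ()
inʳ _ ≟ᴵ mid   = no λ ()
inʳ _ ≟ᴵ inˡ _ = no λ ()
inʳ i ≟ᴵ inʳ j = map′ (cong inʳ) (λ { refl → refl }) (i ≟ᴵ j)

_≟ⱽ_ : ∀ {n} → DecidableEquality (FareyVertex n)
X       ≟ⱽ X       = yes refl
X       ≟ⱽ Y       = no λ ()
X       ≟ⱽ inner _ = no λ ()
Y       ≟ⱽ X       = no λ ()
Y       ≟ⱽ Y       = yes refl
Y       ≟ⱽ inner _ = no λ ()
inner _ ≟ⱽ X       = no λ ()
inner _ ≟ⱽ Y       = no λ ()
inner i ≟ⱽ inner j = map′ (cong inner) (λ { refl → refl }) (i ≟ᴵ j)

allInner : ∀ n → List (Inner n)
allInner zero    = []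
allInner (suc n) = mid ∷ List.map inˡ (allInner n) List.++ List.map inʳ (allInner n)

allInner-complete : ∀ {n} (i : Inner n) → i ∈ᴸ allInner n
allInner-complete mid     = here refl
allInner-complete (inˡ i) = there (∈-++⁺ˡ (∈-map⁺ inˡ (allInner-complete i)))
allInner-complete (inʳ i) = there (∈-++⁺ʳ _ (∈-map⁺ inʳ (allInner-complete i)))

farey : ℕ → Graph
farey n = record
  { Vertex   = FareyVertex n
  ; _≟_      = _≟ⱽ_
  ; vertices = X ∷ Y ∷ List.map inner (allInner n)
  ; complete = λ { X         → here refl
                 ; Y         → there (here refl)
                 ; (inner i) → there (there (∈-map⁺ inner (allInner-complete i))) }
  ; size     = fareySize n
  ; ends     = fareyEnds n
  }

{-# OPTIONS --safe #-}

-- Let r be the probability that the random subgraph H of Gₙ is connected, and s the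
-- probability that X and Y lie in different components of H while every vertex lies in
-- one of these two components.  Gₙ₊₁ is made of two copies of Gₙ and the edge XY.  If that
-- edge is retained, H is connected iff both copies are connected, or one is connected and
-- the other one split as above; if it is deleted, H is connected iff both copies are, and
-- split iff exactly one copy is connected and the other one split.  Hence
--   r' = r² + 2 p r s,   s' = 2 q r s.
-- With t = 2q, uₙ = 1 + t + ... + tⁿ⁻¹ and W = ∏_{1 ≤ i ≤ n} uᵢ^2^(n-i) the solution is
--   r = p^2ⁿ uₙ₊₁ W,   p s = q tⁿ p^2ⁿ W,
-- and it agrees with the stated product because 2ⁱ - q⁻ⁱ = (t - 1) uᵢ / qⁱ.
module Submission where

open import Defs hiding
  (_≈_; _+_; _*_; -_; _-_; _^_; _/_⟨_⟩; ∏; NonZero; 1#; 2#; p; q; q⁻¹)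
open import Algebra.Bundles using (CommutativeRing; CommutativeSemigroup)
import Algebra.Properties.CommutativeSemigroup as CommutativeSemigroupProperties
import Algebra.Properties.CommutativeSemiring.Exp as Exp
import Algebra.Properties.Group as GroupProperties
import Algebra.Solver.Ring.NaturalCoefficients.Default as RingSolver
open import Data.Bool.Base using (true; false; if_then_else_)
open import Data.Empty using (⊥)
open import Data.Fin.Base using (zero; suc)
open import Data.Fin.Subset using (Subset; inside; outside; ∣_∣; ∁)
open import Data.List.Base using ([]; _∷_; foldr; applyUpTo)
open import Data.List.Relation.Unary.All as All using (all?)
open import Data.Nat as ℕ using (ℕ; zero; suc)
import Data.Nat.Properties as ℕₚ
open import Data.Product.Base as Product using (_×_; _,_; proj₁; proj₂; ∃₂)
import Data.Rational.Base as ℚ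
open import Data.Rational.Base using (0ℚ; 1ℚ)
import Data.Rational.Properties as ℚₚ
open import Data.Sum.Base as Sum using (_⊎_; inj₁; inj₂)
open import Data.Vec.Base as Vec using (Vec; []; _∷_; _++_; take; drop; here; there)
open import Data.Vec.Properties using (take++drop≡id; lookup-map)
open import Function.Base using (_∘_; id)
open import Function.Bundles using (_⇔_; mk⇔; module Equivalence)
open import Level using (0ℓ)
open import Relation.Binary.Bundles using (Setoid)
open import Relation.Binary.Construct.Closure.ReflexiveTransitive as Star using (ε; _◅_; _◅◅_)
import Relation.Binary.PropositionalEquality as ≡
open ≡ using (_≡_; refl; cong; cong₂)
import Relation.Binary.Reasoning.Setoid as SetoidReasoning
open import Relation.Nullary using (yes; no; does; ¬_; contradiction)
open import Relation.Nullary.Decidable using (map′; _×-dec_; _⊎-dec_; ¬?; does-⇔; dec-false)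
open import Relation.Unary using (Pred; Decidable)

-- The ring of polynomials

infix 4 _≋_

-- _≈ᴾ_ as a record, so that f and g can be inferred from f ≋ g.
record _≋_ (f g : Poly) : Set where
  constructor coeffwise
  field at : f ≈ᴾ g

open _≋_

≋-refl : ∀ {f} → f ≋ f
≋-refl = coeffwise λ _ → refl

≋-sym : ∀ {f g} → f ≋ g → g ≋ f
≋-sym f≋g = coeffwise λ k → ≡.sym (at f≋g k)

≋-trans : ∀ {f g h} → f ≋ g → g ≋ h → f ≋ h
≋-trans f≋g g≋h = coeffwise λ k → ≡.trans (at f≋g k) (at g≋h k)

≋-setoid : Setoid 0ℓ 0ℓ
≋-setoid = record
  { Carrier = Poly ; _≈_ = _≋_
  ; isEquivalence = record { refl = ≋-refl ; sym = ≋-sym ; trans = ≋-trans } }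

module ≋-Reasoning = SetoidReasoning ≋-setoid

∷-cong : ∀ {a b f g} → a ≡ b → f ≋ g → a ∷ f ≋ b ∷ g
∷-cong a≡b f≋g = coeffwise λ { zero → a≡b ; (suc k) → at f≋g k }

0∷[]≋[] : 0ℚ ∷ [] ≋ []
0∷[]≋[] = coeffwise λ { zero → refl ; (suc _) → refl }

+ᴾ-cong : ∀ {f f′ g g′} → f ≋ f′ → g ≋ g′ → f +ᴾ g ≋ f′ +ᴾ g′
+ᴾ-cong {f} {f′} {g} {g′} f≋f′ g≋g′ = coeffwise λ k → begin
  coeff (f +ᴾ g) k            ≡⟨ coeff-+ f g k ⟩
  coeff f k ℚ.+ coeff g k     ≡⟨ cong₂ ℚ._+_ (at f≋f′ k) (at g≋g′ k) ⟩
  coeff f′ k ℚ.+ coeff g′ k   ≡⟨ coeff-+ f′ g′ k ⟨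
  coeff (f′ +ᴾ g′) k          ∎
  where open ≡.≡-Reasoning

+ᴾ-comm : ∀ f g → f +ᴾ g ≋ g +ᴾ f
+ᴾ-comm []      []      = ≋-refl
+ᴾ-comm []      (b ∷ g) = ≋-refl
+ᴾ-comm (a ∷ f) []      = ≋-refl
+ᴾ-comm (a ∷ f) (b ∷ g) = ∷-cong (ℚₚ.+-comm a b) (+ᴾ-comm f g)

+ᴾ-assoc : ∀ f g h → (f +ᴾ g) +ᴾ h ≋ f +ᴾ (g +ᴾ h)
+ᴾ-assoc []      g       h       = ≋-refl
+ᴾ-assoc (a ∷ f) []      h       = ≋-refl
+ᴾ-assoc (a ∷ f) (b ∷ g) []      = ≋-refl
+ᴾ-assoc (a ∷ f) (b ∷ g) (c ∷ h) = ∷-cong (ℚₚ.+-assoc a b c) (+ᴾ-assoc f g h)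

+ᴾ-identityʳ : ∀ f → f +ᴾ [] ≋ f
+ᴾ-identityʳ f = +ᴾ-comm f []

+ᴾ-inverseˡ : ∀ f → (-ᴾ f) +ᴾ f ≋ []
+ᴾ-inverseˡ []      = ≋-refl
+ᴾ-inverseˡ (a ∷ f) =
  ≋-trans (∷-cong (ℚₚ.+-inverseˡ a) (+ᴾ-inverseˡ f)) 0∷[]≋[]

-ᴾ-cong : ∀ {f g} → f ≋ g → -ᴾ f ≋ -ᴾ g
-ᴾ-cong {f} {g} f≋g = coeffwise λ k →
  ≡.trans (coeff-neg f k) (≡.trans (cong ℚ.-_ (at f≋g k)) (≡.sym (coeff-neg g k)))
  where
  coeff-neg : ∀ f k → coeff (-ᴾ f) k ≡ ℚ.- coeff f k
  coeff-neg []      k       = refl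
  coeff-neg (a ∷ f) zero    = refl
  coeff-neg (a ∷ f) (suc k) = coeff-neg f k

·ᴾ-congʳ : ∀ a {f g} → f ≋ g → a ·ᴾ f ≋ a ·ᴾ g
·ᴾ-congʳ a {f} {g} f≋g = coeffwise λ k →
  ≡.trans (coeff-· a f k) (≡.trans (cong (a ℚ.*_) (at f≋g k)) (≡.sym (coeff-· a g k)))

·ᴾ-distribˡ : ∀ a f g → a ·ᴾ (f +ᴾ g) ≋ (a ·ᴾ f) +ᴾ (a ·ᴾ g)
·ᴾ-distribˡ a []      g       = ≋-refl
·ᴾ-distribˡ a (b ∷ f) []      = ≋-refl
·ᴾ-distribˡ a (b ∷ f) (c ∷ g) = ∷-cong (ℚₚ.*-distribˡ-+ a b c) (·ᴾ-distribˡ a f g)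

·ᴾ-distribʳ : ∀ f a b → (a ℚ.+ b) ·ᴾ f ≋ (a ·ᴾ f) +ᴾ (b ·ᴾ f)
·ᴾ-distribʳ []      a b = ≋-refl
·ᴾ-distribʳ (c ∷ f) a b = ∷-cong (ℚₚ.*-distribʳ-+ c a b) (·ᴾ-distribʳ f a b)

·ᴾ-assoc : ∀ a b f → (a ℚ.* b) ·ᴾ f ≋ a ·ᴾ (b ·ᴾ f)
·ᴾ-assoc a b []      = ≋-refl
·ᴾ-assoc a b (c ∷ f) = ∷-cong (ℚₚ.*-assoc a b c) (·ᴾ-assoc a b f)

·ᴾ-identityˡ : ∀ f → 1ℚ ·ᴾ f ≋ f
·ᴾ-identityˡ []      = ≋-refl
·ᴾ-identityˡ (a ∷ f) = ∷-cong (ℚₚ.*-identityˡ a) (·ᴾ-identityˡ f)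

+ᴾ-commutativeSemigroup : CommutativeSemigroup 0ℓ 0ℓ
+ᴾ-commutativeSemigroup = record
  { Carrier = Poly
  ; _≈_ = _≋_
  ; _∙_ = _+ᴾ_
  ; isCommutativeSemigroup = record
    { isSemigroup = record
      { isMagma = record { isEquivalence = Setoid.isEquivalence ≋-setoid ; ∙-cong = +ᴾ-cong }
      ; assoc   = +ᴾ-assoc }
    ; comm = +ᴾ-comm }
  }

open CommutativeSemigroupProperties +ᴾ-commutativeSemigroup using (interchange; x∙yz≈y∙xz)

*ᴾ-zeroʳ : ∀ f → f *ᴾ [] ≋ []
*ᴾ-zeroʳ []      = ≋-refl
*ᴾ-zeroʳ (a ∷ f) = ≋-trans (∷-cong refl (*ᴾ-zeroʳ f)) 0∷[]≋[]

*ᴾ-congˡ : ∀ f {g h} → g ≋ h → f *ᴾ g ≋ f *ᴾ h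
*ᴾ-congˡ []      g≋h = ≋-refl
*ᴾ-congˡ (a ∷ f) g≋h = +ᴾ-cong (·ᴾ-congʳ a g≋h) (∷-cong refl (*ᴾ-congˡ f g≋h))

-- The mirror image of the defining clause of `_*ᴾ_`, which recurses on the first factor only;
-- commutativity rests on it.
*ᴾ-∷ : ∀ f b g → f *ᴾ (b ∷ g) ≋ (b ·ᴾ f) +ᴾ (0ℚ ∷ (f *ᴾ g))
*ᴾ-∷ []      b g = ≋-sym 0∷[]≋[]
*ᴾ-∷ (a ∷ f) b g = ∷-cong (cong (ℚ._+ 0ℚ) (ℚₚ.*-comm a b)) (begin
  (a ·ᴾ g) +ᴾ (f *ᴾ (b ∷ g))                     ≈⟨ +ᴾ-cong (≋-refl {a ·ᴾ g}) (*ᴾ-∷ f b g) ⟩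
  (a ·ᴾ g) +ᴾ ((b ·ᴾ f) +ᴾ (0ℚ ∷ (f *ᴾ g)))      ≈⟨ x∙yz≈y∙xz (a ·ᴾ g) (b ·ᴾ f) _ ⟩
  (b ·ᴾ f) +ᴾ ((a ·ᴾ g) +ᴾ (0ℚ ∷ (f *ᴾ g)))      ∎)
  where open ≋-Reasoning

*ᴾ-comm : ∀ f g → f *ᴾ g ≋ g *ᴾ f
*ᴾ-comm []      g = ≋-sym (*ᴾ-zeroʳ g)
*ᴾ-comm (a ∷ f) g = ≋-trans
  (+ᴾ-cong (≋-refl {a ·ᴾ g}) (∷-cong refl (*ᴾ-comm f g)))
  (≋-sym (*ᴾ-∷ g a f))

-- Congruence in the first factor is reduced to the second by commutativity: equal polynomials may
-- be lists of different lengths, which does not suit a recursion on the first factor.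
*ᴾ-cong : ∀ {f f′ g g′} → f ≋ f′ → g ≋ g′ → f *ᴾ g ≋ f′ *ᴾ g′
*ᴾ-cong {f} {f′} {g} {g′} f≋f′ g≋g′ = begin
  f *ᴾ g     ≈⟨ *ᴾ-congˡ f g≋g′ ⟩
  f *ᴾ g′    ≈⟨ *ᴾ-comm f g′ ⟩
  g′ *ᴾ f    ≈⟨ *ᴾ-congˡ g′ f≋f′ ⟩
  g′ *ᴾ f′   ≈⟨ *ᴾ-comm g′ f′ ⟩
  f′ *ᴾ g′   ∎
  where open ≋-Reasoning

*ᴾ-distribʳ : ∀ h f g → (f +ᴾ g) *ᴾ h ≋ (f *ᴾ h) +ᴾ (g *ᴾ h)
*ᴾ-distribʳ h []      g       = ≋-refl
*ᴾ-distribʳ h (a ∷ f) []      = ≋-sym (+ᴾ-identityʳ _)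
*ᴾ-distribʳ h (a ∷ f) (b ∷ g) = begin
  ((a ℚ.+ b) ·ᴾ h) +ᴾ (0ℚ ∷ ((f +ᴾ g) *ᴾ h))
    ≈⟨ +ᴾ-cong (·ᴾ-distribʳ h a b) (∷-cong refl (*ᴾ-distribʳ h f g)) ⟩
  ((a ·ᴾ h) +ᴾ (b ·ᴾ h)) +ᴾ ((0ℚ ∷ (f *ᴾ h)) +ᴾ (0ℚ ∷ (g *ᴾ h)))
    ≈⟨ interchange (a ·ᴾ h) (b ·ᴾ h) _ _ ⟩
  ((a ∷ f) *ᴾ h) +ᴾ ((b ∷ g) *ᴾ h) ∎
  where open ≋-Reasoning

*ᴾ-distribˡ : ∀ h f g → h *ᴾ (f +ᴾ g) ≋ (h *ᴾ f) +ᴾ (h *ᴾ g)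
*ᴾ-distribˡ h f g = begin
  h *ᴾ (f +ᴾ g)           ≈⟨ *ᴾ-comm h (f +ᴾ g) ⟩
  (f +ᴾ g) *ᴾ h           ≈⟨ *ᴾ-distribʳ h f g ⟩
  (f *ᴾ h) +ᴾ (g *ᴾ h)    ≈⟨ +ᴾ-cong (*ᴾ-comm f h) (*ᴾ-comm g h) ⟩
  (h *ᴾ f) +ᴾ (h *ᴾ g)    ∎
  where open ≋-Reasoning

·ᴾ-*ᴾ-assoc : ∀ a g h → (a ·ᴾ g) *ᴾ h ≋ a ·ᴾ (g *ᴾ h)
·ᴾ-*ᴾ-assoc a []      h = ≋-refl
·ᴾ-*ᴾ-assoc a (b ∷ g) h = begin
  ((a ℚ.* b) ·ᴾ h) +ᴾ (0ℚ ∷ ((a ·ᴾ g) *ᴾ h))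
    ≈⟨ +ᴾ-cong (·ᴾ-assoc a b h) (∷-cong (≡.sym (ℚₚ.*-zeroʳ a)) (·ᴾ-*ᴾ-assoc a g h)) ⟩
  (a ·ᴾ (b ·ᴾ h)) +ᴾ (a ·ᴾ (0ℚ ∷ (g *ᴾ h)))
    ≈⟨ ·ᴾ-distribˡ a (b ·ᴾ h) _ ⟨
  a ·ᴾ ((b ∷ g) *ᴾ h) ∎
  where open ≋-Reasoning

*ᴾ-assoc : ∀ f g h → (f *ᴾ g) *ᴾ h ≋ f *ᴾ (g *ᴾ h)
*ᴾ-assoc []      g h = ≋-refl
*ᴾ-assoc (a ∷ f) g h = begin
  ((a ·ᴾ g) +ᴾ (0ℚ ∷ (f *ᴾ g))) *ᴾ h
    ≈⟨ *ᴾ-distribʳ h (a ·ᴾ g) _ ⟩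
  ((a ·ᴾ g) *ᴾ h) +ᴾ ((0ℚ ∷ (f *ᴾ g)) *ᴾ h)
    ≈⟨ +ᴾ-cong (·ᴾ-*ᴾ-assoc a g h) (coeffwise (shiftˡ (f *ᴾ g) h)) ⟩
  (a ·ᴾ (g *ᴾ h)) +ᴾ (0ℚ ∷ ((f *ᴾ g) *ᴾ h))
    ≈⟨ +ᴾ-cong (≋-refl {a ·ᴾ (g *ᴾ h)}) (∷-cong refl (*ᴾ-assoc f g h)) ⟩
  (a ∷ f) *ᴾ (g *ᴾ h) ∎
  where open ≋-Reasoning

*ᴾ-identityˡ : ∀ f → (1ℚ ∷ []) *ᴾ f ≋ f
*ᴾ-identityˡ f = begin
  (1ℚ ·ᴾ f) +ᴾ (0ℚ ∷ [])   ≈⟨ +ᴾ-cong (·ᴾ-identityˡ f) 0∷[]≋[] ⟩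
  f +ᴾ []                  ≈⟨ +ᴾ-identityʳ f ⟩
  f                        ∎
  where open ≋-Reasoning

polyRing : CommutativeRing 0ℓ 0ℓ
polyRing = record
  { Carrier = Poly
  ; _≈_ = _≋_
  ; _+_ = _+ᴾ_
  ; _*_ = _*ᴾ_
  ; -_  = -ᴾ_
  ; 0#  = []
  ; 1#  = 1ℚ ∷ []
  ; isCommutativeRing = record
    { isRing = record
      { +-isAbelianGroup = record
        { isGroup = record
          { isMonoid = record
            { isSemigroup = CommutativeSemigroup.isSemigroup +ᴾ-commutativeSemigroup
            ; identity    = (λ _ → ≋-refl) , +ᴾ-identityʳ }
          ; inverse = +ᴾ-inverseˡ , λ f → ≋-trans (+ᴾ-comm f (-ᴾ f)) (+ᴾ-inverseˡ f)
          ; ⁻¹-cong = -ᴾ-cong }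
        ; comm = +ᴾ-comm }
      ; *-cong     = *ᴾ-cong
      ; *-assoc    = *ᴾ-assoc
      ; *-identity = *ᴾ-identityˡ , λ f → ≋-trans (*ᴾ-comm f _) (*ᴾ-identityˡ f)
      ; distrib    = *ᴾ-distribˡ , *ᴾ-distribʳ }
    ; *-comm = *ᴾ-comm }
  }

-- Identities in a commutative ring

module Algebraic (R : CommutativeRing 0ℓ 0ℓ) where
  open CommutativeRing R hiding (zero) renaming (refl to ≈-refl)
  open Exp commutativeSemiring
  open RingSolver commutativeSemiring using (solve; con; _:=_; _:+_; _:*_)
  open SetoidReasoning setoid

  1^n≈1 : ∀ n → 1# ^ n ≈ 1#
  1^n≈1 zero    = ≈-refl
  1^n≈1 (suc n) = trans (*-identityˡ _) (1^n≈1 n)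

  ^-double : ∀ x n → x ^ (2 ℕ.* n) ≈ x ^ n * x ^ n
  ^-double x n = trans (^-homo-* x n (n ℕ.+ 0)) (*-congˡ (^-congʳ x (ℕₚ.+-identityʳ n)))

  ^-double-∸1 : ∀ x n .{{_ : ℕ.NonZero n}} →
                x ^ (2 ℕ.* n ℕ.∸ 1) ≈ x * (x ^ (n ℕ.∸ 1) * x ^ (n ℕ.∸ 1))
  ^-double-∸1 x (suc n) = begin
    x ^ (n ℕ.+ suc (n ℕ.+ 0))   ≈⟨ ^-congʳ x (ℕₚ.+-suc n (n ℕ.+ 0)) ⟩
    x ^ suc (2 ℕ.* n)           ≈⟨ *-congˡ (^-double x n) ⟩
    x * (x ^ n * x ^ n)         ∎

  -- The same fold that `∏` in the theorem unfolds to, over an arbitrary commutative ring.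
  product : (ℕ → Carrier) → ℕ → Carrier
  product f n = foldr _*_ 1# (applyUpTo f n)

  product-cong : ∀ {f g} n → (∀ {k} → k ℕ.< n → f k ≈ g k) → product f n ≈ product g n
  product-cong zero    f≈g = ≈-refl
  product-cong (suc n) f≈g =
    *-cong (f≈g ℕ.z<s) (product-cong n λ k<n → f≈g (ℕ.s<s k<n))

  product-last : ∀ f n → product f (suc n) ≈ product f n * f n
  product-last f zero    = *-comm (f 0) 1#
  product-last f (suc n) = trans (*-congˡ (product-last (f ∘ suc) n)) (sym (*-assoc _ _ _))

  product-square : ∀ f n → product (λ k → f k * f k) n ≈ product f n * product f n
  product-square f zero    = sym (*-identityˡ 1#)
  product-square f (suc n) = trans (*-congˡ (product-square (f ∘ suc) n))
    (solve 2 (λ x y → x :* x :* (y :* y) := x :* y :* (x :* y)) ≈-refl (f 0) _)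

  -- ∏_{2 ≤ i ≤ n} c_i ^ 2^(n-i), for n = suc m and i = 2 + k
  ∏² : (ℕ → Carrier) → ℕ → Carrier
  ∏² c m = product (λ k → c (2 ℕ.+ k) ^ (2 ℕ.^ (m ℕ.∸ suc k))) m

  -- Raising `m` by one doubles every exponent, which squares the old product, and adds a last
  -- factor with exponent `2 ^ 0`.
  ∏²-suc : ∀ c m → ∏² c (suc m) ≈ ∏² c m * ∏² c m * c (2 ℕ.+ m)
  ∏²-suc c m = begin
    ∏² c (suc m)
      ≈⟨ product-last (λ k → c (2 ℕ.+ k) ^ (2 ℕ.^ (suc m ℕ.∸ suc k))) m ⟩
    product (λ k → c (2 ℕ.+ k) ^ (2 ℕ.^ (m ℕ.∸ k))) m * c (2 ℕ.+ m) ^ (2 ℕ.^ (m ℕ.∸ m))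
      ≈⟨ *-cong (product-cong m square) last ⟩
    product (λ k → factor k * factor k) m * c (2 ℕ.+ m)
      ≈⟨ *-congʳ (product-square factor m) ⟩
    ∏² c m * ∏² c m * c (2 ℕ.+ m) ∎
    where
    factor : ℕ → Carrier
    factor k = c (2 ℕ.+ k) ^ (2 ℕ.^ (m ℕ.∸ suc k))
    square : ∀ {k} → k ℕ.< m → c (2 ℕ.+ k) ^ (2 ℕ.^ (m ℕ.∸ k)) ≈ factor k * factor k
    square {k} k<m = trans
      -- As `k < m`, the subtractions are not truncated and `m ∸ k` is one more than `m ∸ suc k`.
      (^-congʳ (c (2 ℕ.+ k)) (≡.cong (2 ℕ.^_) (ℕₚ.+-∸-assoc 1 k<m)))
      (^-double (c (2 ℕ.+ k)) (2 ℕ.^ (m ℕ.∸ suc k)))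
    last : c (2 ℕ.+ m) ^ (2 ℕ.^ (m ℕ.∸ m)) ≈ c (2 ℕ.+ m)
    last = trans (^-congʳ (c (2 ℕ.+ m)) (≡.cong (2 ℕ.^_) (ℕₚ.n∸n≡0 m))) (*-identityʳ _)

  geometric : Carrier → ℕ → Carrier
  geometric t zero    = 0#
  geometric t (suc n) = geometric t n + t ^ n

  -- The identity (t - 1)(1 + t + ... + tⁿ⁻¹) = tⁿ - 1 in a form free of subtraction, so that the
  -- semiring solver applies.
  geometric-sum : ∀ {d t} → d + 1# ≈ t → ∀ n → d * geometric t n + 1# ≈ t ^ n
  geometric-sum {d} {t} d+1≈t zero    = trans (+-congʳ (zeroʳ d)) (+-identityˡ 1#)
  geometric-sum {d} {t} d+1≈t (suc n) = begin
    d * (geometric t n + t ^ n) + 1#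
      ≈⟨ solve 3 (λ d g x → d :* (g :+ x) :+ con 1 := (d :* g :+ con 1) :+ d :* x)
               ≈-refl d (geometric t n) (t ^ n) ⟩
    (d * geometric t n + 1#) + d * t ^ n
      ≈⟨ +-congʳ (geometric-sum d+1≈t n) ⟩
    t ^ n + d * t ^ n
      ≈⟨ solve 2 (λ d x → x :+ d :* x := (d :+ con 1) :* x) ≈-refl d (t ^ n) ⟩
    (d + 1#) * t ^ n
      ≈⟨ *-congʳ d+1≈t ⟩
    t ^ suc n ∎

  -- ∏_{1 ≤ i ≤ n} (geometric t i) ^ 2^(n-i)
  W : Carrier → ℕ → Carrier
  W t zero    = 1#
  W t (suc n) = W t n * W t n * geometric t (suc n)

  -- Collects the powers of `d`: their exponents are 1 and 2ʲ for j < m, with sum 2ᵐ. What remains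
  -- is `W`, whose extra factor i = 1 is a power of u₁ = 1.
  ∏²-geometric : ∀ d t m →
    d * ∏² (λ i → d * geometric t i) m ≈ d ^ (2 ℕ.^ m) * W t (suc m)
  ∏²-geometric d t zero    =
    solve 1 (λ d → d :* con 1 := d :* con 1 :* (con 1 :* con 1 :* (con 0 :+ con 1))) ≈-refl d
  ∏²-geometric d t (suc m) = begin
    d * ∏² a (suc m)
      ≈⟨ *-congˡ (∏²-suc a m) ⟩
    d * (∏² a m * ∏² a m * (d * g))
      ≈⟨ solve 3 (λ d x g → d :* (x :* x :* (d :* g)) := d :* x :* (d :* x) :* g)
               ≈-refl d (∏² a m) g ⟩
    d * ∏² a m * (d * ∏² a m) * g
      ≈⟨ *-congʳ (*-cong (∏²-geometric d t m) (∏²-geometric d t m)) ⟩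
    d ^ (2 ℕ.^ m) * W t (suc m) * (d ^ (2 ℕ.^ m) * W t (suc m)) * g
      ≈⟨ solve 3 (λ x w g → x :* w :* (x :* w) :* g := x :* x :* (w :* w :* g))
               ≈-refl (d ^ (2 ℕ.^ m)) (W t (suc m)) g ⟩
    d ^ (2 ℕ.^ m) * d ^ (2 ℕ.^ m) * W t (2 ℕ.+ m)
      ≈⟨ *-congʳ (^-double d (2 ℕ.^ m)) ⟨
    d ^ (2 ℕ.^ suc m) * W t (2 ℕ.+ m) ∎
    where
    a : ℕ → Carrier
    a i = d * geometric t i
    g = geometric t (2 ℕ.+ m)

  -- Only the total exponent of `q` matters. On both sides it is 2 for m = 0, and passing from m to
  -- m + 1 sends e to 2e + 1.
  ∏²-powers : ∀ q m →
    q ^ (2 ℕ.+ m) * ∏² (q ^_) m ≈ q ^ (2 ℕ.^ suc m ℕ.∸ 1) * q ^ (2 ℕ.^ m)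
  ∏²-powers q zero    =
    solve 1 (λ q → q :* (q :* con 1) :* con 1 := q :* con 1 :* (q :* con 1)) ≈-refl q
  ∏²-powers q (suc m) = begin
    q ^ (3 ℕ.+ m) * ∏² (q ^_) (suc m)
      ≈⟨ *-congˡ (∏²-suc (q ^_) m) ⟩
    q * x * (∏² (q ^_) m * ∏² (q ^_) m * x)
      ≈⟨ solve 3 (λ q x y → q :* x :* (y :* y :* x) := q :* (x :* y :* (x :* y)))
               ≈-refl q x (∏² (q ^_) m) ⟩
    q * (x * ∏² (q ^_) m * (x * ∏² (q ^_) m))
      ≈⟨ *-congˡ (*-cong (∏²-powers q m) (∏²-powers q m)) ⟩
    q * (y * z * (y * z))
      ≈⟨ solve 3 (λ q y z → q :* (y :* z :* (y :* z)) := q :* (y :* y) :* (z :* z))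
               ≈-refl q y z ⟩
    q * (y * y) * (z * z)
      ≈⟨ *-cong (^-double-∸1 q (2 ℕ.^ suc m)) (^-double q (2 ℕ.^ m)) ⟨
    q ^ (2 ℕ.^ (2 ℕ.+ m) ℕ.∸ 1) * q ^ (2 ℕ.^ suc m) ∎
    where
    x = q ^ (2 ℕ.+ m)
    y = q ^ (2 ℕ.^ suc m ℕ.∸ 1)
    z = q ^ (2 ℕ.^ m)
    -- `^-double-∸1` needs a nonzero exponent, since `∸` truncates at 0.
    instance 2^-nonZero = ℕₚ.m^n≢0 2 (suc m)

  module _
    (p q : Carrier) (r s : ℕ → Carrier)
    (r-zero : r 0 ≈ p) (s-zero : s 0 ≈ q)
    (r-suc : ∀ n → r (suc n) ≈ r n * r n + p * (r n * s n + s n * r n))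
    (s-suc : ∀ n → s (suc n) ≈ q * (r n * s n + s n * r n))
    where

    private t = q + q

    -- s is multiplied by p because s n contains the factor p ^ (2 ^ n - 1).
    recurrence-solution : ∀ n →
      r n ≈ p ^ (2 ℕ.^ n) * (geometric t (suc n) * W t n) ×
      p * s n ≈ q * t ^ n * (p ^ (2 ℕ.^ n) * W t n)
    recurrence-solution zero = r₀ , s₀
      where
      r₀ = trans r-zero (solve 1 (λ p → p := p :* con 1 :* ((con 0 :+ con 1) :* con 1)) ≈-refl p)
      s₀ = trans (*-congˡ s-zero)
        (solve 2 (λ p q → p :* q := q :* con 1 :* (p :* con 1 :* con 1)) ≈-refl p q)
    recurrence-solution (suc n) with recurrence-solution n
    ... | r≈ , ps≈ = rₙ₊₁ , sₙ₊₁
      where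
      g = geometric t (suc n)
      w = W t n
      P = p ^ (2 ℕ.^ n)
      T = t ^ n
      rₙ₊₁ = begin
        r (suc n)
          ≈⟨ r-suc n ⟩
        r n * r n + p * (r n * s n + s n * r n)
          ≈⟨ solve 3 (λ p r s → r :* r :+ p :* (r :* s :+ s :* r)
                             := r :* (r :+ (p :* s :+ p :* s))) ≈-refl p (r n) (s n) ⟩
        r n * (r n + (p * s n + p * s n))
          ≈⟨ *-cong r≈ (+-cong r≈ (+-cong ps≈ ps≈)) ⟩
        P * (g * w) * (P * (g * w) + (q * T * (P * w) + q * T * (P * w)))
          -- The two terms `q * T` combine to `t * T`, the next power of `t`, which extends the
          -- geometric sum `g` by one term.
          ≈⟨ solve 5 (λ P g w q T →
                 P :* (g :* w) :* (P :* (g :* w) :+ (q :* T :* (P :* w) :+ q :* T :* (P :* w)))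
                 := P :* P :* ((g :+ (q :+ q) :* T) :* (w :* w :* g))) ≈-refl P g w q T ⟩
        P * P * ((g + t * T) * (w * w * g))
          ≈⟨ *-congʳ (^-double p (2 ℕ.^ n)) ⟨
        p ^ (2 ℕ.^ suc n) * (geometric t (2 ℕ.+ n) * W t (suc n)) ∎
      sₙ₊₁ = begin
        p * s (suc n)
          ≈⟨ *-congˡ (s-suc n) ⟩
        p * (q * (r n * s n + s n * r n))
          ≈⟨ solve 4 (λ p q r s → p :* (q :* (r :* s :+ s :* r))
                               := (q :+ q) :* r :* (p :* s)) ≈-refl p q (r n) (s n) ⟩
        t * r n * (p * s n)
          ≈⟨ *-cong (*-congˡ r≈) ps≈ ⟩
        t * (P * (g * w)) * (q * T * (P * w))
          ≈⟨ solve 6 (λ P g w q T t → t :* (P :* (g :* w)) :* (q :* T :* (P :* w))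
                      := q :* (t :* T) :* (P :* P :* (w :* w :* g))) ≈-refl P g w q T t ⟩
        q * t ^ suc n * (P * P * W t (suc n))
          ≈⟨ *-congˡ (*-congʳ (^-double p (2 ℕ.^ n))) ⟨
        q * t ^ suc n * (p ^ (2 ℕ.^ suc n) * W t (suc n)) ∎

  -- The equality of the solution `r` with the stated product, for n = m + 1 and with denominators
  -- multiplied out. The powers of `d` and of `q` are balanced by `∏²-geometric` and `∏²-powers`.
  closed-form : ∀ p q d t m →
    p ^ (2 ℕ.^ suc m) * (geometric t (2 ℕ.+ m) * W t (suc m))
      * (q ^ (2 ℕ.+ m) * d ^ (2 ℕ.^ m) * ∏² (q ^_) m)
    ≈ q ^ (2 ℕ.^ suc m ℕ.∸ 1) * p ^ (2 ℕ.^ suc m)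
      * (d * geometric t (2 ℕ.+ m) * q ^ (2 ℕ.^ m)) * ∏² (λ i → d * geometric t i) m
  closed-form p q d t m = begin
    P * (g * w) * (Q * D * ∏q)
      ≈⟨ solve 6 (λ P g w Q D ∏q → P :* (g :* w) :* (Q :* D :* ∏q)
                                := P :* g :* (D :* w) :* (Q :* ∏q)) ≈-refl P g w Q D ∏q ⟩
    P * g * (D * w) * (Q * ∏q)
      ≈⟨ *-cong (*-congˡ (sym (∏²-geometric d t m))) (∏²-powers q m) ⟩
    P * g * (d * ∏a) * (y * z)
      ≈⟨ solve 6 (λ P g d ∏a y z → P :* g :* (d :* ∏a) :* (y :* z)
                                := y :* P :* (d :* g :* z) :* ∏a) ≈-refl P g d ∏a y z ⟩
    y * P * (d * g * z) * ∏a ∎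
    where
    P  = p ^ (2 ℕ.^ suc m)
    g  = geometric t (2 ℕ.+ m)
    w  = W t (suc m)
    Q  = q ^ (2 ℕ.+ m)
    D  = d ^ (2 ℕ.^ m)
    y  = q ^ (2 ℕ.^ suc m ℕ.∸ 1)
    z  = q ^ (2 ℕ.^ m)
    ∏q = ∏² (q ^_) m
    ∏a = ∏² (λ i → d * geometric t i) m

-- Probabilities of events

module _ where
  open CommutativeRing polyRing hiding (refl; zero)
  open RingSolver (CommutativeRing.commutativeSemiring polyRing) using (solve; _:=_; _:+_; _:*_)
  open ≋-Reasoning

  ∑-cong : ∀ m {f g : Subset m → Poly} → (∀ H → f H ≋ g H) → ∑Subsets m f ≋ ∑Subsets m g
  ∑-cong zero    f≋g = f≋g []
  ∑-cong (suc m) f≋g = +-cong (∑-cong m (f≋g ∘ (inside ∷_))) (∑-cong m (f≋g ∘ (outside ∷_)))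

  ∑-+ : ∀ m (f g : Subset m → Poly) →
        ∑Subsets m (λ H → f H +ᴾ g H) ≋ ∑Subsets m f +ᴾ ∑Subsets m g
  ∑-+ zero    f g = ≋-refl
  ∑-+ (suc m) f g = begin
    ∑Subsets m (λ H → f (inside ∷ H) +ᴾ g (inside ∷ H)) +ᴾ
    ∑Subsets m (λ H → f (outside ∷ H) +ᴾ g (outside ∷ H))
      ≈⟨ +-cong (∑-+ m (f ∘ (inside ∷_)) (g ∘ (inside ∷_)))
                (∑-+ m (f ∘ (outside ∷_)) (g ∘ (outside ∷_))) ⟩
    _ ≈⟨ solve 4 (λ a b c d → (a :+ b) :+ (c :+ d) := (a :+ c) :+ (b :+ d)) ≋-refl
           (∑Subsets m (f ∘ (inside ∷_))) (∑Subsets m (g ∘ (inside ∷_)))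
           (∑Subsets m (f ∘ (outside ∷_))) (∑Subsets m (g ∘ (outside ∷_))) ⟩
    ∑Subsets (suc m) f +ᴾ ∑Subsets (suc m) g ∎

  ∑-* : ∀ m c (f : Subset m → Poly) → ∑Subsets m (λ H → c *ᴾ f H) ≋ c *ᴾ ∑Subsets m f
  ∑-* zero    c f = ≋-refl
  ∑-* (suc m) c f = ≋-trans
    (+-cong (∑-* m c (f ∘ (inside ∷_))) (∑-* m c (f ∘ (outside ∷_))))
    (≋-sym (distribˡ c (∑Subsets m (f ∘ (inside ∷_))) (∑Subsets m (f ∘ (outside ∷_)))))

  weight : ∀ {m} → Subset m → Poly
  weight H = (pᴾ ^ᴾ ∣ H ∣) *ᴾ (qᴾ ^ᴾ ∣ ∁ H ∣)

  -- The probability of the event `P`, as a polynomial in p. By definition `reliability G` is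
  -- `Pr (connected? G)`.
  Pr : ∀ {m} {P : Pred (Subset m) 0ℓ} → Decidable P → Poly
  Pr {m} P? = ∑Subsets m λ H → if does (P? H) then weight H else []

  Pr-cong : ∀ {m} {P Q : Pred (Subset m) 0ℓ} (P? : Decidable P) (Q? : Decidable Q) →
            (∀ H → P H ⇔ Q H) → Pr P? ≋ Pr Q?
  Pr-cong P? Q? P⇔Q = ∑-cong _ λ H →
    reflexive (≡.cong (if_then weight H else []) (does-⇔ (P⇔Q H) (P? H) (Q? H)))

  Pr-∅ : ∀ {m} {P : Pred (Subset m) 0ℓ} (P? : Decidable P) → (∀ H → ¬ P H) → Pr P? ≋ []
  Pr-∅ {m} P? ∄P = begin
    Pr P?                              ≈⟨ ∑-cong m (λ H → reflexive
                                            (≡.cong (if_then weight H else []) (dec-false (P? H) (∄P H)))) ⟩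
    -- The zero summand is, by computation, a product with the constant `[]`, which can be pulled
    -- out of the sum.
    ∑Subsets m (λ H → [] *ᴾ weight H)  ≈⟨ ∑-* m [] weight ⟩
    []                                 ∎

  Pr-⊎ : ∀ {m} {P Q : Pred (Subset m) 0ℓ} (P? : Decidable P) (Q? : Decidable Q) →
         (∀ {H} → P H → ¬ Q H) → Pr (λ H → P? H ⊎-dec Q? H) ≋ Pr P? +ᴾ Pr Q?
  Pr-⊎ {m} P? Q? disjoint = ≋-trans (∑-cong m split) (∑-+ m _ _)
    where
    split : ∀ H → (if does (P? H ⊎-dec Q? H) then weight H else []) ≋
                  (if does (P? H) then weight H else []) +ᴾ (if does (Q? H) then weight H else [])
    split H with P? H | Q? H
    ... | yes P | yes Q = contradiction Q (disjoint P)
    ... | yes _ | no _  = ≋-sym (+ᴾ-identityʳ (weight H))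
    ... | no _  | _     = ≋-refl

  -- Conditioning on whether the first edge is retained.
  Pr-∷ : ∀ {m} {P : Pred (Subset (suc m)) 0ℓ} (P? : Decidable P) →
         Pr P? ≋ (pᴾ *ᴾ Pr (P? ∘ (inside ∷_))) +ᴾ (qᴾ *ᴾ Pr (P? ∘ (outside ∷_)))
  Pr-∷ {m} P? = +-cong
    (≋-trans (∑-cong m λ H → factor-inside (does (P? (inside ∷ H))) H) (∑-* m pᴾ _))
    (≋-trans (∑-cong m λ H → factor-outside (does (P? (outside ∷ H))) H) (∑-* m qᴾ _))
    where
    factor-inside : ∀ b (H : Subset m) → (if b then weight (inside ∷ H) else []) ≋
                             pᴾ *ᴾ (if b then weight H else [])
    factor-inside true  H = *-assoc pᴾ (pᴾ ^ᴾ ∣ H ∣) (qᴾ ^ᴾ ∣ ∁ H ∣)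
    factor-inside false H = ≋-sym (zeroʳ pᴾ)
    factor-outside : ∀ b (H : Subset m) → (if b then weight (outside ∷ H) else []) ≋
                              qᴾ *ᴾ (if b then weight H else [])
    factor-outside true  H =
      solve 3 (λ q x y → x :* (q :* y) := q :* (x :* y)) ≋-refl qᴾ (pᴾ ^ᴾ ∣ H ∣) (qᴾ ^ᴾ ∣ ∁ H ∣)
    factor-outside false H = ≋-sym (zeroʳ qᴾ)

  Both : ∀ {m k} → Pred (Subset m) 0ℓ → Pred (Subset k) 0ℓ → Pred (Subset (m ℕ.+ k)) 0ℓ
  Both {m} P Q H = P (take m H) × Q (drop m H)

  both? : ∀ {m k} {P : Pred (Subset m) 0ℓ} {Q : Pred (Subset k) 0ℓ} →
          Decidable P → Decidable Q → Decidable (Both P Q)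
  both? {m} P? Q? H = P? (take m H) ×-dec Q? (drop m H)

  -- Events on disjoint sets of edges are independent. The edges of the first set are conditioned on
  -- one at a time.
  Pr-both : ∀ {m k} {P : Pred (Subset m) 0ℓ} {Q : Pred (Subset k) 0ℓ}
            (P? : Decidable P) (Q? : Decidable Q) → Pr (both? P? Q?) ≋ Pr P? *ᴾ Pr Q?
  Pr-both {zero} {k} P? Q? with P? []
  -- With no edges left in the first set, `P` is certain or impossible; if certain, `Pr P?` is the
  -- weight of `[]`, that is 1 times 1.
  ... | yes _ = ≋-sym (≋-trans (*-congʳ {Pr Q?} (*-identityˡ (1#))) (*-identityˡ (Pr Q?)))
  ... | no _  = Pr-∅ {k} {λ _ → ⊥} (λ _ → no λ ()) (λ _ ())
  Pr-both {suc m} P? Q? = begin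
    Pr (both? P? Q?)
      ≈⟨ Pr-∷ (both? P? Q?) ⟩
    (pᴾ *ᴾ Pr (both? (P? ∘ (inside ∷_)) Q?)) +ᴾ (qᴾ *ᴾ Pr (both? (P? ∘ (outside ∷_)) Q?))
      ≈⟨ +-cong (*-congˡ {pᴾ} (Pr-both (P? ∘ (inside ∷_)) Q?))
                (*-congˡ {qᴾ} (Pr-both (P? ∘ (outside ∷_)) Q?)) ⟩
    (pᴾ *ᴾ (Pr (P? ∘ (inside ∷_)) *ᴾ Pr Q?)) +ᴾ (qᴾ *ᴾ (Pr (P? ∘ (outside ∷_)) *ᴾ Pr Q?))
      ≈⟨ solve 5 (λ p q x y z → p :* (x :* z) :+ q :* (y :* z) := (p :* x :+ q :* y) :* z) ≋-refl
           pᴾ qᴾ (Pr (P? ∘ (inside ∷_))) (Pr (P? ∘ (outside ∷_))) (Pr Q?) ⟩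
    ((pᴾ *ᴾ Pr (P? ∘ (inside ∷_))) +ᴾ (qᴾ *ᴾ Pr (P? ∘ (outside ∷_)))) *ᴾ Pr Q?
      ≈⟨ *-congʳ {Pr Q?} (Pr-∷ P?) ⟨
    Pr P? *ᴾ Pr Q? ∎

-- Connectivity of the Farey graphs

module _ {V : Set} where

  Edges : ℕ → Set
  Edges = Vec (V × V)

  adj-++⁺ˡ : ∀ {m k} (es : Edges m) {fs : Edges k} {H K u v} →
             Adj es H u v → Adj (es ++ fs) (H ++ K) u v
  adj-++⁺ˡ (_ ∷ _)  (zero  , here      , eq) = zero , here , eq
  adj-++⁺ˡ (_ ∷ es) (suc i , there i∈H , eq) = weaken (adj-++⁺ˡ es (i , i∈H , eq))

  adj-++⁺ʳ : ∀ {m k} (es : Edges m) {fs : Edges k} H {K u v} →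
             Adj fs K u v → Adj (es ++ fs) (H ++ K) u v
  adj-++⁺ʳ []       []      adj = adj
  adj-++⁺ʳ (_ ∷ es) (_ ∷ H) adj = weaken (adj-++⁺ʳ es H adj)

  adj-++⁻ : ∀ {m k} (es : Edges m) {fs : Edges k} H {K u v} →
            Adj (es ++ fs) (H ++ K) u v → Adj es H u v ⊎ Adj fs K u v
  adj-++⁻ []       []      adj                      = inj₂ adj
  adj-++⁻ (_ ∷ es) (_ ∷ H) (zero  , here      , eq) = inj₁ (zero , here , eq)
  adj-++⁻ (_ ∷ es) (_ ∷ H) (suc i , there i∈H , eq) =
    Sum.map₁ weaken (adj-++⁻ es H (i , i∈H , eq))

  joined-sym : ∀ {m} (es : Edges m) {H u v} → Joined es H u v → Joined es H v u
  joined-sym es = Star.reverse λ (i , i∈H , eq) → i , i∈H , Sum.swap eq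

  joined-outside : ∀ {m} {es : Edges m} {e H u v} →
                   Joined (e ∷ es) (outside ∷ H) u v ⇔ Joined es H u v
  joined-outside = mk⇔ (Star.map strengthen) (Star.map weaken)

module _ {V W : Set} (f : V → W) where

  adj-map⁺ : ∀ {m} (es : Vec (V × V) m) {H u v} →
             Adj es H u v → Adj (Vec.map (Product.map f f) es) H (f u) (f v)
  adj-map⁺ es (i , i∈H , eq) = i , i∈H , Sum.map image image eq
    where
    image : ∀ {e} → Vec.lookup es i ≡ e →
            Vec.lookup (Vec.map (Product.map f f) es) i ≡ Product.map f f e
    image eq = ≡.trans (lookup-map i (Product.map f f) es) (≡.cong (Product.map f f) eq)

  adj-map⁻ : ∀ {m} (es : Vec (V × V) m) {H u v} →
             Adj (Vec.map (Product.map f f) es) H u v →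
             ∃₂ λ a b → f a ≡ u × f b ≡ v × Adj es H a b
  -- Abstracting the looked-up edge lets `lookup-map` identify it with the image of an edge of `es`,
  -- whose endpoints are the witnesses.
  adj-map⁻ es (i , i∈H , eq) with Vec.lookup (Vec.map (Product.map f f) es) i
                                | lookup-map i (Product.map f f) es | eq
  ... | _ | refl | inj₁ refl = _ , _ , refl , refl , i , i∈H , inj₁ refl
  ... | _ | refl | inj₂ refl = _ , _ , refl , refl , i , i∈H , inj₂ refl

-- Being connected and being split in two differ only in whether X and Y are linked, so the two
-- conditions are treated separately. The edge vector is arbitrary so as to cover the graph without
-- the edge XY as well.
Attached Linked Conn Split : ∀ {n m} → Vec (FareyVertex n × FareyVertex n) m → Pred (Subset m) 0ℓ
Attached es H = ∀ v → Joined es H v X ⊎ Joined es H v Y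
Linked   es H = Joined es H X Y
Conn     es H = Attached es H × Linked es H
Split    es H = Attached es H × ¬ Linked es H

module _ {n m} (es : Vec (FareyVertex n × FareyVertex n) m) where

  linked? : Decidable (Linked es)
  linked? H = joined? _≟ⱽ_ es H X Y

  attached? : Decidable (Attached es)
  attached? H = map′
    (λ all v → All.lookup all (Graph.complete (farey n) v))
    (λ att → All.tabulate λ {v} _ → att v)
    (all? (λ v → joined? _≟ⱽ_ es H v X ⊎-dec joined? _≟ⱽ_ es H v Y) (Graph.vertices (farey n)))

  conn? : Decidable (Conn es)
  conn? H = attached? H ×-dec linked? H

  split? : Decidable (Split es)
  split? H = attached? H ×-dec ¬? (linked? H)

-- Once X and Y are linked, every attached vertex reaches X, and any two vertices are joined through
-- X.
connected⇔conn : ∀ n H → Connected (farey n) H ⇔ Conn (fareyEnds n) H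
connected⇔conn n H = mk⇔
  (λ conn → (λ v → inj₁ (conn v X)) , conn X Y)
  (λ (att , X~Y) u v →
    let toX : ∀ v → Joined (fareyEnds n) H v X
        toX v = Sum.[ id , (λ r → r ◅◅ joined-sym (fareyEnds n) X~Y) ]′ (att v)
    in toX u ◅◅ joined-sym (fareyEnds n) (toX v))

module _ {n m} {es : Vec (FareyVertex n × FareyVertex n) m} {H : Subset m} where

  attached-outside : ∀ {e} → Attached (e ∷ es) (outside ∷ H) ⇔ Attached es H
  attached-outside = mk⇔
    (λ att v → Sum.map (Star.map strengthen) (Star.map strengthen) (att v))
    (λ att v → Sum.map (Star.map weaken) (Star.map weaken) (att v))

  -- A walk that uses the edge XY has already reached X or Y before its first use of it.
  attached-inside : Attached ((X , Y) ∷ es) (inside ∷ H) ⇔ Attached es H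
  attached-inside = mk⇔
    (λ att v → Sum.[ viaX , viaY ]′ (att v))
    (λ att v → Sum.map (Star.map weaken) (Star.map weaken) (att v))
    where
    viaX : ∀ {v} → Joined ((X , Y) ∷ es) (inside ∷ H) v X → Joined es H v X ⊎ Joined es H v Y
    viaX r with toVia r
    ... | inj₁ s              = inj₁ s
    ... | inj₂ (inj₁ (s , _)) = inj₁ s
    ... | inj₂ (inj₂ (s , _)) = inj₂ s
    viaY : ∀ {v} → Joined ((X , Y) ∷ es) (inside ∷ H) v Y → Joined es H v X ⊎ Joined es H v Y
    viaY r with toVia r
    ... | inj₁ s              = inj₂ s
    ... | inj₂ (inj₁ (s , _)) = inj₁ s
    ... | inj₂ (inj₂ (s , _)) = inj₂ s

  linked-inside : Linked ((X , Y) ∷ es) (inside ∷ H)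
  linked-inside = (zero , here , inj₁ refl) ◅ ε

-- ρ¹ contracts the second copy to the glued vertex, which is Y of the first copy, so
-- a walk in the two glued copies projects to a walk in the first one; ρ² is its mirror.
ρ¹ ρ² : ∀ {n} → FareyVertex (suc n) → FareyVertex n
ρ¹ X               = X
ρ¹ Y               = Y
ρ¹ (inner mid)     = Y
ρ¹ (inner (inˡ i)) = inner i
ρ¹ (inner (inʳ _)) = Y
ρ² X               = X
ρ² Y               = Y
ρ² (inner mid)     = X
ρ² (inner (inˡ _)) = X
ρ² (inner (inʳ i)) = inner i

ρ¹-copy¹ : ∀ {n} (v : FareyVertex n) → ρ¹ (copy¹ v) ≡ v
ρ¹-copy¹ X         = refl
ρ¹-copy¹ Y         = refl
ρ¹-copy¹ (inner _) = refl

ρ¹-copy² : ∀ {n} (v : FareyVertex n) → ρ¹ (copy² v) ≡ Y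
ρ¹-copy² X         = refl
ρ¹-copy² Y         = refl
ρ¹-copy² (inner _) = refl

ρ²-copy¹ : ∀ {n} (v : FareyVertex n) → ρ² (copy¹ v) ≡ X
ρ²-copy¹ X         = refl
ρ²-copy¹ Y         = refl
ρ²-copy¹ (inner _) = refl

ρ²-copy² : ∀ {n} (v : FareyVertex n) → ρ² (copy² v) ≡ v
ρ²-copy² X         = refl
ρ²-copy² Y         = refl
ρ²-copy² (inner _) = refl

-- The two copies sharing `inner mid`, without the new edge XY, which `fareyEnds` lists first.
glued : ∀ n → Vec (FareyVertex (suc n) × FareyVertex (suc n)) (fareySize n ℕ.+ fareySize n)
glued n = Vec.tail (fareyEnds (suc n))

module _ {n} (H K : Subset (fareySize n)) where

  private
    es  = fareyEnds n
    es¹ = Vec.map (Product.map copy¹ copy¹) es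
    es² = Vec.map (Product.map copy² copy²) es

  lift¹ : ∀ {u v} → Joined es H u v → Joined (glued n) (H ++ K) (copy¹ u) (copy¹ v)
  lift¹ = Star.gmap copy¹ λ adj → adj-++⁺ˡ es¹ (adj-map⁺ copy¹ es adj)

  lift² : ∀ {u v} → Joined es K u v → Joined (glued n) (H ++ K) (copy² u) (copy² v)
  lift² = Star.gmap copy² λ adj → adj-++⁺ʳ es¹ H (adj-map⁺ copy² es adj)

  contract¹ : ∀ {u v} → Joined (glued n) (H ++ K) u v → Joined es H (ρ¹ u) (ρ¹ v)
  contract¹ = Star.kleisliStar ρ¹ λ adj → step (adj-++⁻ es¹ H adj)
    where
    step : ∀ {u v} → Adj es¹ H u v ⊎ Adj es² K u v → Joined es H (ρ¹ u) (ρ¹ v)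
    step (inj₁ adj) with adj-map⁻ copy¹ es adj
    ... | a , b , refl , refl , adj′ rewrite ρ¹-copy¹ a | ρ¹-copy¹ b = Star.return adj′
    step (inj₂ adj) with adj-map⁻ copy² es adj
    ... | a , b , refl , refl , _ rewrite ρ¹-copy² a | ρ¹-copy² b = ε

  contract² : ∀ {u v} → Joined (glued n) (H ++ K) u v → Joined es K (ρ² u) (ρ² v)
  contract² = Star.kleisliStar ρ² λ adj → step (adj-++⁻ es¹ H adj)
    where
    step : ∀ {u v} → Adj es¹ H u v ⊎ Adj es² K u v → Joined es K (ρ² u) (ρ² v)
    step (inj₁ adj) with adj-map⁻ copy¹ es adj
    ... | a , b , refl , refl , _ rewrite ρ²-copy¹ a | ρ²-copy¹ b = ε
    step (inj₂ adj) with adj-map⁻ copy² es adj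
    ... | a , b , refl , refl , adj′ rewrite ρ²-copy² a | ρ²-copy² b = Star.return adj′

  -- The glued vertex is a cut vertex: a walk from X to Y contracts to one across each copy, and
  -- conversely such walks meet there.
  linked-glued : Linked (glued n) (H ++ K) ⇔ (Linked es H × Linked es K)
  linked-glued = mk⇔ (λ r → contract¹ r , contract² r) (λ (r , s) → lift¹ r ◅◅ lift² s)

  -- The last condition expresses that the glued vertex itself reaches X through the first copy or Y
  -- through the second. Vertices that reach only the glued vertex within their copy then continue
  -- from it.
  attached-glued : Attached (glued n) (H ++ K) ⇔
                   (Attached es H × Attached es K × (Linked es H ⊎ Linked es K))
  attached-glued = mk⇔ to from
    where
    to : Attached (glued n) (H ++ K) → _
    to att = (λ v → ≡.subst (λ w → Joined es H w X ⊎ Joined es H w Y) (ρ¹-copy¹ v)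
                      (Sum.map contract¹ contract¹ (att (copy¹ v))))
           , (λ v → ≡.subst (λ w → Joined es K w X ⊎ Joined es K w Y) (ρ²-copy² v)
                      (Sum.map contract² contract² (att (copy² v))))
           , Sum.map (joined-sym es ∘ contract¹) contract² (att (inner mid))

    from : Attached es H × Attached es K × (Linked es H ⊎ Linked es K) →
           Attached (glued n) (H ++ K)
    from (attH , attK , linked) = λ
      { X               → inj₁ ε
      ; Y               → inj₂ ε
      ; (inner mid)     → mid~
      ; (inner (inˡ i)) → Sum.[ inj₁ ∘ lift¹ , (λ r → Sum.map (lift¹ r ◅◅_) (lift¹ r ◅◅_) mid~) ]′
                            (attH (inner i))
      ; (inner (inʳ i)) → Sum.[ (λ r → Sum.map (lift² r ◅◅_) (lift² r ◅◅_) mid~) , inj₂ ∘ lift² ]′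
                            (attK (inner i)) }
      where
      mid~ : Joined (glued n) (H ++ K) (inner mid) X ⊎ Joined (glued n) (H ++ K) (inner mid) Y
      mid~ = Sum.map (joined-sym (glued n) ∘ lift¹) lift² linked

  open Equivalence

  -- The retained edge links X and Y, so only attachment counts. The cases are split by which copies
  -- are linked, which makes them mutually exclusive, as `Pr-⊎` requires.
  conn-inside : Conn (fareyEnds (suc n)) (inside ∷ (H ++ K)) ⇔
                (Conn es H × Conn es K ⊎ (Conn es H × Split es K ⊎ Split es H × Conn es K))
  conn-inside = mk⇔ to′ from′
    where
    to′ : Conn (fareyEnds (suc n)) (inside ∷ (H ++ K)) → _
    to′ (att , _) with to attached-glued (to attached-inside att) | linked? es H | linked? es K
    ... | attH , attK , _ | yes h | yes k = inj₁ ((attH , h) , (attK , k))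
    ... | attH , attK , _ | yes h | no ¬k = inj₂ (inj₁ ((attH , h) , (attK , ¬k)))
    ... | attH , attK , _ | no ¬h | yes k = inj₂ (inj₂ ((attH , ¬h) , (attK , k)))
    ... | _ , _ , inj₁ h  | no ¬h | no _  = contradiction h ¬h
    ... | _ , _ , inj₂ k  | no _  | no ¬k = contradiction k ¬k
    attached : Attached es H × Attached es K × (Linked es H ⊎ Linked es K) →
               Conn (fareyEnds (suc n)) (inside ∷ (H ++ K))
    attached att = from attached-inside (from attached-glued att) , linked-inside
    from′ : _ → Conn (fareyEnds (suc n)) (inside ∷ (H ++ K))
    from′ (inj₁ ((attH , h) , (attK , _)))        = attached (attH , attK , inj₁ h)
    from′ (inj₂ (inj₁ ((attH , h) , (attK , _)))) = attached (attH , attK , inj₁ h)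
    from′ (inj₂ (inj₂ ((attH , _) , (attK , k)))) = attached (attH , attK , inj₂ k)

  conn-outside : Conn (fareyEnds (suc n)) (outside ∷ (H ++ K)) ⇔ (Conn es H × Conn es K)
  conn-outside = mk⇔
    (λ (att , l) → let attH , attK , _ = to attached-glued (to attached-outside att)
                       h , k = to linked-glued (to joined-outside l)
                   in (attH , h) , (attK , k))
    (λ ((attH , h) , (attK , k)) →
      from attached-outside (from attached-glued (attH , attK , inj₁ h)) ,
      from joined-outside (from linked-glued (h , k)))

  -- Attachment forces at least one copy to be linked, and X and Y being unlinked forbids both, so
  -- exactly one is.
  split-outside : Split (fareyEnds (suc n)) (outside ∷ (H ++ K)) ⇔
                  (Conn es H × Split es K ⊎ Split es H × Conn es K)
  split-outside = mk⇔ to′ from′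
    where
    to′ : Split (fareyEnds (suc n)) (outside ∷ (H ++ K)) → _
    to′ (att , ¬l) with to attached-glued (to attached-outside att) | linked? es H | linked? es K
    ... | _               | yes h | yes k =
      contradiction (from joined-outside (from linked-glued (h , k))) ¬l
    ... | attH , attK , _ | yes h | no ¬k = inj₁ ((attH , h) , (attK , ¬k))
    ... | attH , attK , _ | no ¬h | yes k = inj₂ ((attH , ¬h) , (attK , k))
    ... | _ , _ , inj₁ h  | no ¬h | no _  = contradiction h ¬h
    ... | _ , _ , inj₂ k  | no _  | no ¬k = contradiction k ¬k
    unlinked : ¬ (Linked es H × Linked es K) →
               ¬ Linked (fareyEnds (suc n)) (outside ∷ (H ++ K))
    unlinked ¬hk l = ¬hk (to linked-glued (to joined-outside l))
    from′ : _ → Split (fareyEnds (suc n)) (outside ∷ (H ++ K))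
    from′ (inj₁ ((attH , h) , (attK , ¬k))) =
      from attached-outside (from attached-glued (attH , attK , inj₁ h)) , unlinked (¬k ∘ proj₂)
    from′ (inj₂ ((attH , ¬h) , (attK , k))) =
      from attached-outside (from attached-glued (attH , attK , inj₂ k)) , unlinked (¬h ∘ proj₁)

-- Passes from the form `H ++ K` of the graph lemmas to the form with `take` and `drop` in `Both`.
onHalves : ∀ {m k} {E : Pred (Subset (m ℕ.+ k)) 0ℓ} {F : Subset m → Subset k → Set} →
           (∀ H K → E (H ++ K) ⇔ F H K) → ∀ L → E L ⇔ F (take m L) (drop m L)
onHalves {m} {E = E} {F} E⇔F L =
  ≡.subst (λ L′ → E L′ ⇔ F (take m L) (drop m L)) (take++drop≡id m L)
    (E⇔F (take m L) (drop m L))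

-- The recurrence for `r` and `s`

r s : ℕ → Poly
r n = Pr (conn? (fareyEnds n))
s n = Pr (split? (fareyEnds n))

reliability≋r : ∀ n → reliability (farey n) ≋ r n
reliability≋r n =
  Pr-cong (connected? (farey n)) (conn? (fareyEnds n)) (connected⇔conn n)

r-zero : r 0 ≋ pᴾ
r-zero = coeffwise λ { 0 → refl ; 1 → refl ; 2 → refl ; (suc (suc (suc _))) → refl }

s-zero : s 0 ≋ qᴾ
s-zero = coeffwise λ { 0 → refl ; 1 → refl ; 2 → refl ; (suc (suc (suc _))) → refl }

p+q≋1 : pᴾ +ᴾ qᴾ ≋ CommutativeRing.1# polyRing
p+q≋1 = coeffwise λ { 0 → refl ; 1 → refl ; (suc (suc _)) → refl }

module _ (n : ℕ) where
  open CommutativeRing polyRing hiding (refl; zero)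
  open RingSolver (CommutativeRing.commutativeSemiring polyRing) using (solve; _:=_; _:+_; _:*_)
  open ≋-Reasoning
  private
    C? = conn? (fareyEnds n)
    S? = split? (fareyEnds n)
    CC? = both? C? C?
    CS? = both? C? S?
    SC? = both? S? C?
    conn′? = conn? (fareyEnds (suc n))
    split′? = split? (fareyEnds (suc n))
    mixed? = λ H → CS? H ⊎-dec SC? H

  Pr-mixed : Pr mixed? ≋ (r n *ᴾ s n) +ᴾ (s n *ᴾ r n)
  Pr-mixed = begin
    Pr mixed?                        ≈⟨ Pr-⊎ CS? SC? (λ ((_ , h) , _) ((_ , ¬h) , _) → ¬h h) ⟩
    Pr CS? +ᴾ Pr SC?                 ≈⟨ +-cong (Pr-both C? S?) (Pr-both S? C?) ⟩
    (r n *ᴾ s n) +ᴾ (s n *ᴾ r n)     ∎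

  r-suc : r (suc n) ≋ (r n *ᴾ r n) +ᴾ (pᴾ *ᴾ ((r n *ᴾ s n) +ᴾ (s n *ᴾ r n)))
  r-suc = begin
    r (suc n)
      ≈⟨ Pr-∷ conn′? ⟩
    (pᴾ *ᴾ Pr (conn′? ∘ (inside ∷_))) +ᴾ
    (qᴾ *ᴾ Pr (conn′? ∘ (outside ∷_)))
      ≈⟨ +-cong (*-congˡ {pᴾ} (Pr-cong (conn′? ∘ (inside ∷_)) (λ H → CC? H ⊎-dec mixed? H) (onHalves conn-inside)))
                (*-congˡ {qᴾ} (Pr-cong (conn′? ∘ (outside ∷_)) CC? (onHalves conn-outside))) ⟩
    (pᴾ *ᴾ Pr (λ H → CC? H ⊎-dec mixed? H)) +ᴾ (qᴾ *ᴾ Pr CC?)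
      ≈⟨ +-congʳ {qᴾ *ᴾ Pr CC?} (*-congˡ {pᴾ} (Pr-⊎ CC? mixed? λ
           { (_ , (_ , k)) (inj₁ (_ , (_ , ¬k))) → ¬k k
           ; ((_ , h) , _) (inj₂ ((_ , ¬h) , _)) → ¬h h })) ⟩
    (pᴾ *ᴾ (Pr CC? +ᴾ Pr mixed?)) +ᴾ (qᴾ *ᴾ Pr CC?)
      -- Both copies being connected suffices whether or not XY is retained, so that event has total
      -- coefficient p + q = 1.
      ≈⟨ solve 4 (λ p q x y → p :* (x :+ y) :+ q :* x := (p :+ q) :* x :+ p :* y) ≋-refl
           pᴾ qᴾ (Pr CC?) (Pr mixed?) ⟩
    ((pᴾ +ᴾ qᴾ) *ᴾ Pr CC?) +ᴾ (pᴾ *ᴾ Pr mixed?)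
      ≈⟨ +-cong (*-cong p+q≋1 (Pr-both C? C?)) (*-congˡ {pᴾ} Pr-mixed) ⟩
    (1# *ᴾ (r n *ᴾ r n)) +ᴾ (pᴾ *ᴾ ((r n *ᴾ s n) +ᴾ (s n *ᴾ r n)))
      ≈⟨ +-congʳ {pᴾ *ᴾ ((r n *ᴾ s n) +ᴾ (s n *ᴾ r n))} (*-identityˡ (r n *ᴾ r n)) ⟩
    (r n *ᴾ r n) +ᴾ (pᴾ *ᴾ ((r n *ᴾ s n) +ᴾ (s n *ᴾ r n))) ∎

  s-suc : s (suc n) ≋ qᴾ *ᴾ ((r n *ᴾ s n) +ᴾ (s n *ᴾ r n))
  s-suc = begin
    s (suc n)
      ≈⟨ Pr-∷ split′? ⟩
    (pᴾ *ᴾ Pr (split′? ∘ (inside ∷_))) +ᴾ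
    (qᴾ *ᴾ Pr (split′? ∘ (outside ∷_)))
      -- A retained edge XY excludes a split.
      ≈⟨ +-cong (*-congˡ {pᴾ} (Pr-∅ (split′? ∘ (inside ∷_)) λ _ (_ , ¬l) → ¬l linked-inside))
                (*-congˡ {qᴾ} (≋-trans (Pr-cong (split′? ∘ (outside ∷_)) mixed? (onHalves split-outside)) Pr-mixed)) ⟩
    (pᴾ *ᴾ []) +ᴾ (qᴾ *ᴾ ((r n *ᴾ s n) +ᴾ (s n *ᴾ r n)))
      ≈⟨ +-congʳ {qᴾ *ᴾ ((r n *ᴾ s n) +ᴾ (s n *ᴾ r n))} (zeroʳ pᴾ) ⟩
    qᴾ *ᴾ ((r n *ᴾ s n) +ᴾ (s n *ᴾ r n)) ∎

-- Rational functions

open Defs using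
  (_≈_; _+_; _*_; -_; _-_; _^_; _/_⟨_⟩; ∏; NonZero; 1#; 2#; p; q; q⁻¹)

module ℙ where
  open CommutativeRing polyRing public
  open Exp commutativeSemiring public
  open GroupProperties +-group public using (∙-cancelʳ)

open ℙ using () renaming (_^_ to infixr 8 _^ᴿ_)
open Algebraic polyRing
open ≋-Reasoning

-- Numerator and denominator are tracked separately, not up to _≈_: that way no
-- common factor ever has to be cancelled.
record _≐_/_ (x : RatFun) (f g : Poly) : Set where
  constructor _,_
  field
    num≋ : num x ≋ f
    den≋ : den x ≋ g

open _≐_/_

≐-cong : ∀ {x f f′ g g′} → f ≋ f′ → g ≋ g′ → x ≐ f / g → x ≐ f′ / g′
≐-cong f≋ g≋ (a , b) = ≋-trans a f≋ , ≋-trans b g≋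

≐-* : ∀ {x y f g h k} → x ≐ f / g → y ≐ h / k → (x * y) ≐ f *ᴾ h / (g *ᴾ k)
≐-* (a , b) (c , d) = *ᴾ-cong a c , *ᴾ-cong b d

≐-÷ : ∀ {x y f g h k} (y≢0 : NonZero y) → x ≐ f / g → y ≐ h / k →
      (x / y ⟨ y≢0 ⟩) ≐ f *ᴾ k / (g *ᴾ h)
≐-÷ _ (a , b) (c , d) = *ᴾ-cong a d , *ᴾ-cong b c

≐-^ : ∀ {x f g} → x ≐ f / g → ∀ n → (x ^ n) ≐ f ^ᴿ n / (g ^ᴿ n)
≐-^ x≐ zero    = ≋-refl , ≋-refl
≐-^ x≐ (suc n) = ≐-* x≐ (≐-^ x≐ n)

≐-product : ∀ {x f g} → (∀ k → x k ≐ f k / g k) → ∀ n →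
            foldr _*_ 1# (applyUpTo x n) ≐ product f n / product g n
≐-product x≐ zero    = ≋-refl , ≋-refl
≐-product x≐ (suc n) = ≐-* (x≐ 0) (≐-product (x≐ ∘ suc) n)

1ᴾ 2ᴾ tᴾ dᴾ : Poly
1ᴾ = ℙ.1#
2ᴾ = num 2#
tᴾ = qᴾ +ᴾ qᴾ
dᴾ = tᴾ +ᴾ (-ᴾ 1ᴾ)

q≐ : q ≐ qᴾ / 1ᴾ
q≐ = coeffwise (λ { 0 → refl ; 1 → refl ; 2 → refl ; (suc (suc (suc _))) → refl })
   , coeffwise (λ { 0 → refl ; (suc _) → refl })

q⁻¹≐ : q⁻¹ ≐ 1ᴾ / qᴾ
q⁻¹≐ = ≐-cong (ℙ.*-identityʳ 1ᴾ) (ℙ.*-identityˡ qᴾ) (≐-÷ {1#} {q} q≢0 (≋-refl , ≋-refl) q≐)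

2q≋t : 2ᴾ *ᴾ qᴾ ≋ tᴾ
2q≋t = coeffwise λ { 0 → refl ; 1 → refl ; 2 → refl ; (suc (suc (suc _))) → refl }

d+1≋t : dᴾ +ᴾ 1ᴾ ≋ tᴾ
d+1≋t = begin
  (tᴾ +ᴾ (-ᴾ 1ᴾ)) +ᴾ 1ᴾ   ≈⟨ ℙ.+-assoc tᴾ (-ᴾ 1ᴾ) 1ᴾ ⟩
  tᴾ +ᴾ ((-ᴾ 1ᴾ) +ᴾ 1ᴾ)   ≈⟨ ℙ.+-congˡ {tᴾ} (ℙ.-‿inverseˡ 1ᴾ) ⟩
  tᴾ +ᴾ []               ≈⟨ ℙ.+-identityʳ tᴾ ⟩
  tᴾ                     ∎

2-q⁻¹≐ : (2# - q⁻¹) ≐ dᴾ / qᴾ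
2-q⁻¹≐ = coeffwise (λ { 0 → refl ; 1 → refl ; 2 → refl ; 3 → refl
                      ; (suc (suc (suc (suc _)))) → refl })
       , ≋-trans (ℙ.*-identityˡ (den q⁻¹)) (den≋ q⁻¹≐)

-- Over the denominator qⁱ the numerator is (2q)ⁱ - 1, which `geometric-sum` factors with t = 2q and
-- d = 2q - 1.
2^i-q⁻ⁱ≐ : ∀ i → (2# ^ i - q⁻¹ ^ i) ≐ dᴾ *ᴾ geometric tᴾ i / (qᴾ ^ᴿ i)
2^i-q⁻ⁱ≐ i = num-eq , den-eq
  where
  den2^ : den (2# ^ i) ≋ 1ᴾ
  den2^ = ≋-trans (den≋ (≐-^ {2#} (≋-refl , ≋-refl) i)) (1^n≈1 i)
  num2^ : num (2# ^ i) ≋ 2ᴾ ^ᴿ i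
  num2^ = num≋ (≐-^ {2#} (≋-refl , ≋-refl) i)
  numq⁻ : num (q⁻¹ ^ i) ≋ 1ᴾ
  numq⁻ = ≋-trans (num≋ (≐-^ q⁻¹≐ i)) (1^n≈1 i)
  denq⁻ : den (q⁻¹ ^ i) ≋ qᴾ ^ᴿ i
  denq⁻ = den≋ (≐-^ q⁻¹≐ i)
  den-eq : den (2# ^ i) *ᴾ den (q⁻¹ ^ i) ≋ qᴾ ^ᴿ i
  den-eq = ≋-trans (*ᴾ-cong den2^ denq⁻) (ℙ.*-identityˡ (qᴾ ^ᴿ i))
  num-eq : (num (2# ^ i) *ᴾ den (q⁻¹ ^ i)) +ᴾ ((-ᴾ num (q⁻¹ ^ i)) *ᴾ den (2# ^ i)) ≋
           dᴾ *ᴾ geometric tᴾ i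
  -- Adding 1 to both sides turns each into tⁱ and matches the subtraction-free `geometric-sum`.
  num-eq = ℙ.∙-cancelʳ 1ᴾ _ _ (begin
    ((num (2# ^ i) *ᴾ den (q⁻¹ ^ i)) +ᴾ ((-ᴾ num (q⁻¹ ^ i)) *ᴾ den (2# ^ i))) +ᴾ 1ᴾ
      ≈⟨ ℙ.+-congʳ {1ᴾ} (ℙ.+-cong (*ᴾ-cong num2^ denq⁻) (*ᴾ-cong (ℙ.-‿cong numq⁻) den2^)) ⟩
    ((2ᴾ ^ᴿ i *ᴾ qᴾ ^ᴿ i) +ᴾ ((-ᴾ 1ᴾ) *ᴾ 1ᴾ)) +ᴾ 1ᴾ
      ≈⟨ ℙ.+-assoc (2ᴾ ^ᴿ i *ᴾ qᴾ ^ᴿ i) ((-ᴾ 1ᴾ) *ᴾ 1ᴾ) 1ᴾ ⟩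
    (2ᴾ ^ᴿ i *ᴾ qᴾ ^ᴿ i) +ᴾ (((-ᴾ 1ᴾ) *ᴾ 1ᴾ) +ᴾ 1ᴾ)
      ≈⟨ ℙ.+-congˡ {2ᴾ ^ᴿ i *ᴾ qᴾ ^ᴿ i} (ℙ.trans (ℙ.+-congʳ {1ᴾ} (ℙ.*-identityʳ (-ᴾ 1ᴾ)))
                                                 (ℙ.-‿inverseˡ 1ᴾ)) ⟩
    (2ᴾ ^ᴿ i *ᴾ qᴾ ^ᴿ i) +ᴾ []
      ≈⟨ ℙ.+-identityʳ (2ᴾ ^ᴿ i *ᴾ qᴾ ^ᴿ i) ⟩
    2ᴾ ^ᴿ i *ᴾ qᴾ ^ᴿ i
      ≈⟨ ℙ.^-distrib-* 2ᴾ qᴾ i ⟨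
    (2ᴾ *ᴾ qᴾ) ^ᴿ i
      ≈⟨ ℙ.^-congˡ i 2q≋t ⟩
    tᴾ ^ᴿ i
      ≈⟨ geometric-sum {dᴾ} {tᴾ} d+1≋t i ⟨
    (dᴾ *ᴾ geometric tᴾ i) +ᴾ 1ᴾ ∎)

-- Reads off numerator and denominator factor by factor; dividing by a power of d / q moves q into
-- the numerator and d into the denominator.
rhs≐ : ∀ m → let n = suc m in
  (q ^ (2 ℕ.^ n ℕ.∸ 1) * p ^ (2 ℕ.^ n)
    * ((2# ^ (n ℕ.+ 1) - q⁻¹ ^ (n ℕ.+ 1))
        / (2# - q⁻¹) ^ (2 ℕ.^ (n ℕ.∸ 1)) ⟨ ^-nonZero 2-q⁻¹≢0 (2 ℕ.^ (n ℕ.∸ 1)) ⟩)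
    * ∏[ 2 ≤ i ≤ n ] ((2# ^ i - q⁻¹ ^ i) ^ (2 ℕ.^ (n ℕ.∸ i))))
  ≐ qᴾ ^ᴿ (2 ℕ.^ n ℕ.∸ 1) *ᴾ pᴾ ^ᴿ (2 ℕ.^ n)
      *ᴾ (dᴾ *ᴾ geometric tᴾ (2 ℕ.+ m) *ᴾ qᴾ ^ᴿ (2 ℕ.^ m)) *ᴾ ∏² (λ i → dᴾ *ᴾ geometric tᴾ i) m
    / (qᴾ ^ᴿ (2 ℕ.+ m) *ᴾ dᴾ ^ᴿ (2 ℕ.^ m) *ᴾ ∏² (qᴾ ^ᴿ_) m)
-- Turns the exponent `n + 1` into `2 + m`.
rhs≐ m rewrite ℕₚ.+-comm m 1 =
  -- The powers of `q` and `p` contribute only powers of 1 to the denominator, which are dropped.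
  ≐-* (≐-cong ≋-refl (≋-trans (ℙ.*-congʳ {den₃} 1ᴬ1ᴮ≋1) (ℙ.*-identityˡ den₃))
    (≐-* (≐-* (≐-^ q≐ A) (≐-^ p≐ B))
         (≐-÷ (^-nonZero 2-q⁻¹≢0 (2 ℕ.^ m)) (2^i-q⁻ⁱ≐ (2 ℕ.+ m)) (≐-^ 2-q⁻¹≐ (2 ℕ.^ m)))))
    (≐-product (λ k → ≐-^ (2^i-q⁻ⁱ≐ (2 ℕ.+ k)) (2 ℕ.^ (m ℕ.∸ suc k))) m)
  where
  A = 2 ℕ.^ suc m ℕ.∸ 1
  B = 2 ℕ.^ suc m
  den₃ = qᴾ ^ᴿ (2 ℕ.+ m) *ᴾ dᴾ ^ᴿ (2 ℕ.^ m)
  p≐ : p ≐ pᴾ / 1ᴾ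
  p≐ = ≋-refl , ≋-refl
  1ᴬ1ᴮ≋1 : 1ᴾ ^ᴿ A *ᴾ 1ᴾ ^ᴿ B ≋ 1ᴾ
  1ᴬ1ᴮ≋1 = ≋-trans (*ᴾ-cong (1^n≈1 A) (1^n≈1 B)) (ℙ.*-identityˡ 1ᴾ)

-- The closed form of the reliability polynomial

reliability-closed : ∀ n →
  reliability (farey n) ≋ pᴾ ^ᴿ (2 ℕ.^ n) *ᴾ (geometric tᴾ (suc n) *ᴾ W tᴾ n)
reliability-closed n = ≋-trans (reliability≋r n)
  (proj₁ (recurrence-solution pᴾ qᴾ r s r-zero s-zero r-suc s-suc n))

mainTheorem5 : ∀ (n : ℕ) → 1 ℕ.≤ n →
    fromPoly (reliability (farey n)) ≈
      q ^ (2 ℕ.^ n ℕ.∸ 1) * p ^ (2 ℕ.^ n)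
        * ((2# ^ (n ℕ.+ 1) - q⁻¹ ^ (n ℕ.+ 1))
            / (2# - q⁻¹) ^ (2 ℕ.^ (n ℕ.∸ 1)) ⟨ ^-nonZero 2-q⁻¹≢0 (2 ℕ.^ (n ℕ.∸ 1)) ⟩)
        * ∏[ 2 ≤ i ≤ n ] ((2# ^ i - q⁻¹ ^ i) ^ (2 ℕ.^ (n ℕ.∸ i)))
mainTheorem5 (suc m) _ = _≋_.at
  -- `_≈_` cross-multiplies, which is the shape of `closed-form`; the denominator of `fromPoly` is
  -- 1.
  (≋-trans (*ᴾ-cong (reliability-closed (suc m)) (den≋ (rhs≐ m)))
  (≋-trans (closed-form pᴾ qᴾ dᴾ tᴾ m)
  (≋-trans (≋-sym (num≋ (rhs≐ m)))
           (≋-sym (ℙ.*-identityʳ _)))))
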